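{- Let $S$ be a $CW(60,36)$ and let $\chi$ be a character of $C_{60}$ of order $60$. Then $\chi(S)$ is equivalent to $\theta_1$ or $\theta_2$, where, with $\zeta=\zeta_{60}$, $$\theta_1=-3\zeta^{15}-2\zeta^{14}+\zeta^{11}+2\zeta^{10}+\zeta^9+4\zeta^8+2\zeta^6+5\zeta^5+2\zeta^4-4\zeta^2-\zeta-4,$$ $$\theta_2=-\zeta^{15}+\zeta^{14}-3\zeta^{11}-\zeta^{10}-3\zeta^9-2\zeta^8-\zeta^6+5\zeta^5-\zeta^4+2\zeta^2+3\zeta.$$
   Context: $C_{60}$ is the cyclic group of order $60$ and $\zeta_{60}$ a primitive $60$-th root of unity. A $CW(60,36)$ is an element $S=\sum_ga_gg\in\mathbb{Z}[C_{60}]$ with all $a_g\in\{0,\pm1\}$ and $SS^{(-1)}=36$, where $S^{(-1)}=\sum_ga_gg^{ -1}$. For a character $\chi$, $\chi(S)=\sum_ga_g\chi(g)$. Two elements $X,Y\in\mathbb{Z}[\zeta_{60}]$ are equivalent if $Y=\eta X^{\sigma}$ for some $\sigma\in\mathrm{Gal}(\mathbb{Q}(\zeta_{60})/\mathbb{Q})$ and some root of unity $\eta$. -}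

module Defs where

open import Data.Nat as ℕ using (ℕ; zero; suc; _≤_; _<_)
open import Data.Nat.DivMod using (_mod_)
open import Data.Nat.Coprimality using (Coprime)
open import Data.Fin using (Fin; toℕ)
open import Data.Fin.Properties using ()
open import Data.Integer using (ℤ; +_; -_; _+_; _*_; 0ℤ; 1ℤ; -1ℤ)
open import Data.List using (List; []; _∷_; map; foldr; replicate; _++_; allFin)
open import Data.List.Relation.Unary.All using (All)
open import Data.Product using (Σ; ∃; _×_; _,_)
open import Data.Sum using (_⊎_)
open import Relation.Binary.PropositionalEquality using (_≡_)
open import Relation.Nullary using (¬_)

-- The cyclic group C₆₀ = ⟨g⟩, with g^k represented by k : Fin 60.

C60 : Set
C60 = Fin 60

_⊕_ : C60 → C60 → C60
a ⊕ b = (toℕ a ℕ.+ toℕ b) mod 60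

⊖_ : C60 → C60
⊖ a = (60 ℕ.∸ toℕ a) mod 60

e : C60
e = 0 mod 60

sumℤ : List ℤ → ℤ
sumℤ = foldr _+_ 0ℤ

-- The group ring ℤ[C₆₀]: S = Σ_g S(g) g.

GR : Set
GR = C60 → ℤ

_·GR_ : GR → GR → GR
(A ·GR B) k = sumℤ (map (λ g → A g * B ((⊖ g) ⊕ k)) (allFin 60))

inv : GR → GR
inv S g = S (⊖ g)

constGR : ℤ → GR
constGR n k with toℕ k
... | zero  = n
... | suc _ = 0ℤ

IsCW60-36 : GR → Set
IsCW60-36 S =
  (∀ g → S g ≡ 0ℤ ⊎ S g ≡ 1ℤ ⊎ S g ≡ -1ℤ) ×
  (∀ k → (S ·GR inv S) k ≡ constGR (+ 36) k)

-- Integer polynomials as coefficient lists (constant term first).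

Poly : Set
Poly = List ℤ

addP : Poly → Poly → Poly
addP []       ys       = ys
addP (x ∷ xs) []       = x ∷ xs
addP (x ∷ xs) (y ∷ ys) = (x + y) ∷ addP xs ys

negP : Poly → Poly
negP = map -_

scaleP : ℤ → Poly → Poly
scaleP c = map (c *_)

mulP : Poly → Poly → Poly
mulP []       ys = []
mulP (x ∷ xs) ys = addP (scaleP x ys) (0ℤ ∷ mulP xs ys)

monoP : ℕ → Poly
monoP k = replicate k 0ℤ ++ (1ℤ ∷ [])

IsZeroP : Poly → Set
IsZeroP p = All (_≡ 0ℤ) p

-- ℤ[ζ₆₀] ≅ ℤ[x]/(Φ₆₀(x)), ζ₆₀ ↦ x.  Elements are represented by integer
-- polynomials in ζ = ζ₆₀; equality is congruence modulo Φ₆₀.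

Φ60 : Poly
Φ60 = 1ℤ ∷ 0ℤ ∷ 1ℤ ∷ 0ℤ ∷ 0ℤ ∷ 0ℤ ∷ -1ℤ ∷ 0ℤ ∷ -1ℤ ∷ 0ℤ ∷ -1ℤ ∷ 0ℤ ∷ 0ℤ ∷ 0ℤ
      ∷ 1ℤ ∷ 0ℤ ∷ 1ℤ ∷ []

Zζ : Set
Zζ = Poly

infix 4 _≈ζ_
_≈ζ_ : Zζ → Zζ → Set
X ≈ζ Y = ∃ λ (q : Poly) → IsZeroP (addP X (negP (addP Y (mulP q Φ60))))

oneζ : Zζ
oneζ = 1ℤ ∷ []

ζ^ : ℕ → Zζ
ζ^ = monoP

_*ζ_ : Zζ → Zζ → Zζ
_*ζ_ = mulP

powζ : Zζ → ℕ → Zζ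
powζ x zero    = oneζ
powζ x (suc n) = x *ζ powζ x n

IsRootOfUnity : Zζ → Set
IsRootOfUnity η = ∃ λ (n : ℕ) → 1 ≤ n × powζ η n ≈ζ oneζ

-- The Galois automorphism σ_t : ζ ↦ ζ^t (t coprime to 60),
-- applied to a polynomial representative: Σ cᵢ ζ^i ↦ Σ cᵢ ζ^(t i).
σ : ℕ → Zζ → Zζ
σ t []       = []
σ t (c ∷ cs) = addP (c ∷ []) (mulP (monoP t) (σ t cs))

-- X and Y are equivalent: Y = η X^σ for some σ ∈ Gal(ℚ(ζ₆₀)/ℚ) and
-- some root of unity η.  Gal(ℚ(ζ₆₀)/ℚ) = { σ_t : gcd(t,60) = 1 }.
Equivalent : Zζ → Zζ → Set
Equivalent X Y =
  ∃ λ (t : ℕ) → Coprime t 60 ×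
  ∃ λ (η : Zζ) → IsRootOfUnity η × (Y ≈ζ (η *ζ σ t X))

-- Characters of C₆₀ (with values in ℤ[ζ₆₀] ⊂ ℂ, which contains all
-- 60th roots of unity): group homomorphisms C₆₀ → ℤ[ζ₆₀]^×.

IsCharacter : (C60 → Zζ) → Set
IsCharacter χ = (χ e ≈ζ oneζ) × (∀ a b → χ (a ⊕ b) ≈ζ (χ a *ζ χ b))

-- χ has order 60 (in the character group): χ^n is nontrivial for 0 < n < 60.
-- (χ^60 is trivial for every character.)
HasOrder60 : (C60 → Zζ) → Set
HasOrder60 χ = ∀ n → 1 ≤ n → n < 60 → ¬ (∀ g → powζ (χ g) n ≈ζ oneζ)

applyChar : (C60 → Zζ) → GR → Zζ
applyChar χ S = foldr addP [] (map (λ g → scaleP (S g) (χ g)) (allFin 60))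

θ₁ : Zζ
θ₁ = - + 4 ∷ -1ℤ ∷ - + 4 ∷ 0ℤ ∷ + 2 ∷ + 5 ∷ + 2 ∷ 0ℤ ∷ + 4 ∷ + 1 ∷ + 2 ∷ + 1
     ∷ 0ℤ ∷ 0ℤ ∷ - + 2 ∷ - + 3 ∷ []

θ₂ : Zζ
θ₂ = 0ℤ ∷ + 3 ∷ + 2 ∷ 0ℤ ∷ -1ℤ ∷ + 5 ∷ -1ℤ ∷ 0ℤ ∷ - + 2 ∷ - + 3 ∷ -1ℤ ∷ - + 3
     ∷ 0ℤ ∷ 0ℤ ∷ + 1 ∷ -1ℤ ∷ []

{-# OPTIONS --safe #-}
-- There is no CW(60,36), so the theorem holds vacuously. For the coefficient sequence f of S put
-- q h = f h + f (30 + h) and a h = f h − f (30 + h). Then q ≡ a mod 2, |q| + |a| ≤ 2, and the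
-- autocorrelations of q (period 30) and a (negacyclic) are 36 at shift 0 and vanish elsewhere. Group the
-- indices modulo 30 into the ten cosets of C₃ ("rows"). As 3 is self-conjugate modulo 10, two descent
-- steps at the prime above 3 show that q is constant modulo 3 on each row. As 2 is self-conjugate modulo
-- 5, the row sums of a, and with them those of q, are even. So one row of q is ±(2, 2, 2), and the other
-- rows have sum 0; as the norm is 36, four of them are ±(1, 1, −2) up to order and five vanish. The
-- positions of the entries ±2 determine a modulo 2. A search over these positions, over the row sums of a
-- (a negacyclic sequence of length 10 and norm 36) and over the entries of a modulo 4 and then modulo 128
-- finds no sequence a with the required autocorrelation.
module Submission where

open import Defs
open import Algebra.Bundles using (AbelianGroup)
open import Algebra.Properties.CommutativeSemigroup using (x∙yz≈y∙xz)
open import Algebra.Properties.Group using (∙-cancelˡ)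
open import Data.Bool using (Bool; true; false; _∧_; _∨_; if_then_else_)
open import Data.Bool.ListAction using (all)
open import Data.Bool.Properties using (T-≡)
open import Data.Empty using (⊥; ⊥-elim)
open import Data.Fin as Fin using (Fin; toℕ)
import Data.Fin.Properties as Fin
open import Data.Integer as ℤ using (ℤ; +_; -[1+_]; -_; _+_; _*_; _-_; 0ℤ; 1ℤ; -1ℤ; ∣_∣)
open import Data.Integer.DivMod using (_%ℕ_; _/ℕ_; a≡a%ℕn+[a/ℕn]*n; n%ℕd<d)
open import Data.Integer.Divisibility.Signed using (_∣_; divides; ∣⇒∣ᵤ; ∣m∣n⇒∣m+n; ∣n⇒∣m*n; ∣m⇒∣m*n)
open import Data.Integer.Properties
open import Data.Integer.Tactic.RingSolver using (solve-∀)
open import Data.List using (List; []; _∷_; _++_; map; zipWith; length; allFin; applyUpTo; concatMap)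
open import Data.List.Membership.Propositional using (_∈_)
import Data.List.Membership.DecPropositional as DecMembership
open import Data.List.Properties using (≡-dec; map-cong; map-applyUpTo; length-++; length-map)
open import Data.List.Relation.Unary.Any using (here; there)
open import Data.Nat as ℕ using (ℕ; zero; suc; s≤s; z≤n; NonZero; _≡ᵇ_; _≤ᵇ_)
open import Data.Nat.DivMod using (_mod_; [m+n]%n≡m%n; m≡m%n+[m/n]*n; m%n<n)
import Data.Nat.Divisibility as ℕ
import Data.Nat.Properties as ℕ
open import Data.Product using (∃; _×_; _,_; proj₁; proj₂)
import Data.Product.Properties as ×
open import Data.Sum as Sum using (_⊎_; inj₁; inj₂)
open import Data.Unit using (tt)
open import Function using (_∘_)
open import Function.Bundles using (Equivalence)
open import Relation.Binary.PropositionalEquality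
open import Relation.Nullary using (Dec; yes)
open import Relation.Nullary.Decidable using (⌊_⌋; toWitness; map′; _×-dec_; _⊎-dec_; _→-dec_)
open ≡-Reasoning
open DecMembership (≡-dec ℕ._≟_) using (_∈?_)

-- Sums and autocorrelations

-- Opaque, so that sums with literal bounds are not unfolded by the conversion checker.
opaque

  ∑ : ℕ → (ℕ → ℤ) → ℤ
  ∑ zero    F = 0ℤ
  ∑ (suc n) F = F 0 + ∑ n (F ∘ suc)

  ∑-cong : ∀ n {F G : ℕ → ℤ} → (∀ h → F h ≡ G h) → ∑ n F ≡ ∑ n G
  ∑-cong zero    eq = refl
  ∑-cong (suc n) eq = cong₂ _+_ (eq 0) (∑-cong n (eq ∘ suc))

  ∑-+ : ∀ n (F G : ℕ → ℤ) → ∑ n (λ h → F h + G h) ≡ ∑ n F + ∑ n G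
  ∑-+ zero    F G = refl
  ∑-+ (suc n) F G = trans (cong (_+_ (F 0 + G 0)) (∑-+ n (F ∘ suc) (G ∘ suc))) (swap (F 0) (G 0) _ _)
    where
    swap : ∀ a b c d → (a + b) + (c + d) ≡ (a + c) + (b + d)
    swap = solve-∀

  ∑-* : ∀ n k (F : ℕ → ℤ) → ∑ n (λ h → k * F h) ≡ k * ∑ n F
  ∑-* zero    k F = sym (*-zeroʳ k)
  ∑-* (suc n) k F = trans (cong (_+_ (k * F 0)) (∑-* n k (F ∘ suc))) (sym (*-distribˡ-+ k (F 0) _))

  ∑-split : ∀ m n (F : ℕ → ℤ) → ∑ (m ℕ.+ n) F ≡ ∑ m F + ∑ n (λ h → F (m ℕ.+ h))
  ∑-split zero    n F = sym (+-identityˡ _)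
  ∑-split (suc m) n F = trans (cong (_+_ (F 0)) (∑-split m n (F ∘ suc))) (sym (+-assoc (F 0) _ _))

  ∑-1 : ∀ F → ∑ 1 F ≡ F 0
  ∑-1 F = +-identityʳ (F 0)

  ∑-zero : ∀ F → ∑ 0 F ≡ 0ℤ
  ∑-zero F = refl

  ∑-suc : ∀ n F → ∑ (suc n) F ≡ F 0 + ∑ n (F ∘ suc)
  ∑-suc n F = refl

  ∑-allFin : ∀ (F : C60 → ℕ → ℤ) → sumℤ (map (λ g → F g (toℕ g)) (allFin 60)) ≡ ∑ 60 (λ h → F (h mod 60) h)
  ∑-allFin F = refl

-- Induction on `k`: a shift by one trades `F 0` for `F n`, which agree by periodicity.
∑-rotate : ∀ n k (F : ℕ → ℤ) → (∀ h → F (n ℕ.+ h) ≡ F h) → ∑ n (λ h → F (k ℕ.+ h)) ≡ ∑ n F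
∑-rotate n zero    F per = refl
∑-rotate n (suc k) F per = trans (∑-rotate n k (F ∘ suc) per′) (∙-cancelˡ (AbelianGroup.group +-0-abelianGroup) (F 0) _ _ (begin
    F 0 + ∑ n (F ∘ suc)        ≡⟨ sym (∑-suc n F) ⟩
    ∑ (suc n) F                ≡⟨ cong (λ m → ∑ m F) (ℕ.+-comm 1 n) ⟩
    ∑ (n ℕ.+ 1) F              ≡⟨ ∑-split n 1 F ⟩
    ∑ n F + ∑ 1 (λ h → F (n ℕ.+ h)) ≡⟨ cong (_+_ (∑ n F)) (trans (∑-1 _) (per 0)) ⟩
    ∑ n F + F 0                ≡⟨ +-comm (∑ n F) (F 0) ⟩
    F 0 + ∑ n F                ∎))
  where
  per′ : ∀ h → F (suc (n ℕ.+ h)) ≡ F (suc h)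
  per′ h = trans (cong F (sym (ℕ.+-suc n h))) (per (suc h))

-- The cyclic or negacyclic autocorrelation of f, provided that f (n + h) ≡ ε f h with ε = ±1.
corr : ℕ → (ℕ → ℤ) → ℕ → ℤ
corr n f c = ∑ n (λ h → f h * f (c ℕ.+ h))

+-swap : ∀ c n h → c ℕ.+ (n ℕ.+ h) ≡ n ℕ.+ (c ℕ.+ h)
+-swap = x∙yz≈y∙xz ℕ.+-commutativeSemigroup

-- Reduction of the polynomial with coefficients `f h` modulo x³⁰ - ε. From there `fold₃` reduces
-- modulo x¹⁰ - ε, where x²⁰ becomes ε² = 1.
fold₂ : ℤ → (ℕ → ℤ) → ℕ → ℤ
fold₂ ε f h = f h + ε * f (30 ℕ.+ h)

fold₃ : ℤ → (ℕ → ℤ) → ℕ → ℤ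
fold₃ ε f h = f h + ε * f (10 ℕ.+ h) + f (20 ℕ.+ h)

module _ {ε : ℤ} (ε² : ε * ε ≡ 1ℤ) where

  fold₂-periodic : ∀ f → (∀ h → f (60 ℕ.+ h) ≡ f h) → ∀ h → fold₂ ε f (30 ℕ.+ h) ≡ ε * fold₂ ε f h
  fold₂-periodic f per h = begin
    y + ε * f (60 ℕ.+ h)   ≡⟨ cong (λ z → y + ε * z) (per h) ⟩
    y + ε * x              ≡⟨ cong (_+ ε * x) (trans (sym (*-identityˡ y)) (cong (_* y) (sym ε²))) ⟩
    ε * ε * y + ε * x      ≡⟨ lemma ε x y ⟩
    ε * (x + ε * y)        ∎
    where
    x = f h
    y = f (30 ℕ.+ h)
    lemma : ∀ e x y → e * e * y + e * x ≡ e * (x + e * y)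
    lemma = solve-∀

  -- Reduction modulo x³⁰ - ε is a ring homomorphism compatible with inversion, so the
  -- autocorrelations at c and 30 + c merge.
  corr-fold₂ : ∀ f → (∀ h → f (60 ℕ.+ h) ≡ f h) → ∀ c →
               corr 30 (fold₂ ε f) c ≡ corr 60 f c + ε * corr 60 f (30 ℕ.+ c)
  corr-fold₂ f per c = begin
    ∑ 30 (λ h → fold₂ ε f h * fold₂ ε f (c ℕ.+ h))
      ≡⟨ ∑-cong 30 pointwise ⟩
    ∑ 30 (λ h → (F h + F (30 ℕ.+ h)) + ε * (G h + G (30 ℕ.+ h)))
      ≡⟨ ∑-+ 30 (λ h → F h + F (30 ℕ.+ h)) (λ h → ε * (G h + G (30 ℕ.+ h))) ⟩
    ∑ 30 (λ h → F h + F (30 ℕ.+ h)) + ∑ 30 (λ h → ε * (G h + G (30 ℕ.+ h)))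
      ≡⟨ cong₂ _+_ (merge F) (trans (∑-* 30 ε (λ h → G h + G (30 ℕ.+ h))) (cong (ε *_) (merge G))) ⟩
    corr 60 f c + ε * corr 60 f (30 ℕ.+ c) ∎
    where
    F G : ℕ → ℤ
    F h = f h * f (c ℕ.+ h)
    G h = f h * f (30 ℕ.+ c ℕ.+ h)
    merge : ∀ H → ∑ 30 (λ h → H h + H (30 ℕ.+ h)) ≡ ∑ 60 H
    merge H = trans (∑-+ 30 H (λ h → H (30 ℕ.+ h))) (sym (∑-split 30 30 H))
    expand : ∀ e x y u v → (x + e * y) * (u + e * v) ≡ (x * u + e * e * (y * v)) + e * (x * v + y * u)
    expand = solve-∀
    pointwise : ∀ h → fold₂ ε f h * fold₂ ε f (c ℕ.+ h) ≡ (F h + F (30 ℕ.+ h)) + ε * (G h + G (30 ℕ.+ h))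
    pointwise h rewrite +-swap c 30 h | per (c ℕ.+ h) = begin
      (x + ε * y) * (u + ε * v)                        ≡⟨ expand ε x y u v ⟩
      (x * u + ε * ε * (y * v)) + ε * (x * v + y * u)  ≡⟨ cong (λ s → (x * u + s * (y * v)) + ε * (x * v + y * u)) ε² ⟩
      (x * u + 1ℤ * (y * v)) + ε * (x * v + y * u)     ≡⟨ cong (λ s → (x * u + s) + ε * (x * v + y * u)) (*-identityˡ (y * v)) ⟩
      (x * u + y * v) + ε * (x * v + y * u)            ∎
      where
      x = f h
      y = f (30 ℕ.+ h)
      u = f (c ℕ.+ h)
      v = f (30 ℕ.+ (c ℕ.+ h))

  fold₃-periodic : ∀ x → (∀ h → x (30 ℕ.+ h) ≡ ε * x h) → ∀ h → fold₃ ε x (10 ℕ.+ h) ≡ ε * fold₃ ε x h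
  fold₃-periodic x per h = begin
    x₁ + ε * x₂ + x (30 ℕ.+ h)         ≡⟨ cong (λ z → x₁ + ε * x₂ + z) (per h) ⟩
    x₁ + ε * x₂ + ε * x₀               ≡⟨ cong (λ z → z + ε * x₂ + ε * x₀) (trans (sym (*-identityˡ x₁)) (cong (_* x₁) (sym ε²))) ⟩
    ε * ε * x₁ + ε * x₂ + ε * x₀       ≡⟨ lemma ε x₀ x₁ x₂ ⟩
    ε * (x₀ + ε * x₁ + x₂)             ∎
    where
    x₀ = x h
    x₁ = x (10 ℕ.+ h)
    x₂ = x (20 ℕ.+ h)
    lemma : ∀ e x y z → e * e * y + e * z + e * x ≡ e * (x + e * y + z)
    lemma = solve-∀

∑-third : ∀ (F : ℕ → ℤ) → ∑ 30 F ≡ ∑ 10 (λ h → F h + F (10 ℕ.+ h) + F (20 ℕ.+ h))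
∑-third F = begin
  ∑ 30 F                                  ≡⟨ ∑-split 10 20 F ⟩
  ∑ 10 F + ∑ 20 F₁                        ≡⟨ cong (_+_ (∑ 10 F)) (∑-split 10 10 F₁) ⟩
  ∑ 10 F + (∑ 10 F₁ + ∑ 10 F₂)            ≡⟨ sym (+-assoc (∑ 10 F) (∑ 10 F₁) (∑ 10 F₂)) ⟩
  ∑ 10 F + ∑ 10 F₁ + ∑ 10 F₂              ≡⟨ cong (_+ ∑ 10 F₂) (sym (∑-+ 10 F F₁)) ⟩
  ∑ 10 (λ h → F h + F₁ h) + ∑ 10 F₂       ≡⟨ sym (∑-+ 10 (λ h → F h + F₁ h) F₂) ⟩
  ∑ 10 (λ h → F h + F₁ h + F₂ h)          ∎
  where
  F₁ F₂ : ℕ → ℤ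
  F₁ h = F (10 ℕ.+ h)
  F₂ h = F (20 ℕ.+ h)

-- Summed over the cosets h, 10 + h, 20 + h, the shifts by c, 10 + c and 20 + c are the three cyclic
-- pairings of row h with row c + h; `ε` appears where an index gains a full 30.
module Rows {ε : ℤ} (x : ℕ → ℤ) (per : ∀ h → x (30 ℕ.+ h) ≡ ε * x h) (c : ℕ) where

  private
    corr-rows : ∀ k → corr 30 x (k ℕ.+ c) ≡
      ∑ 10 (λ h → x h * x (k ℕ.+ (c ℕ.+ h)) + x (10 ℕ.+ h) * x (k ℕ.+ (10 ℕ.+ (c ℕ.+ h))) + x (20 ℕ.+ h) * x (k ℕ.+ (20 ℕ.+ (c ℕ.+ h))))
    corr-rows k = trans (∑-third (λ h → x h * x (k ℕ.+ c ℕ.+ h))) (∑-cong 10 (λ h → cong₂ _+_ (cong₂ _+_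
      (cong (λ i → x h * x i) (ℕ.+-assoc k c h))
      (cong (λ i → x (10 ℕ.+ h) * x i) (trans (ℕ.+-assoc k c _) (cong (k ℕ.+_) (+-swap c 10 h)))))
      (cong (λ i → x (20 ℕ.+ h) * x i) (trans (ℕ.+-assoc k c _) (cong (k ℕ.+_) (+-swap c 20 h))))))

  corr₀ : corr 30 x c ≡ ∑ 10 (λ h → x h * x (c ℕ.+ h) + x (10 ℕ.+ h) * x (10 ℕ.+ (c ℕ.+ h)) + x (20 ℕ.+ h) * x (20 ℕ.+ (c ℕ.+ h)))
  corr₀ = corr-rows 0

  corr₁ : corr 30 x (10 ℕ.+ c) ≡ ∑ 10 (λ h → x h * x (10 ℕ.+ (c ℕ.+ h)) + x (10 ℕ.+ h) * x (20 ℕ.+ (c ℕ.+ h)) + x (20 ℕ.+ h) * (ε * x (c ℕ.+ h)))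
  corr₁ = trans (corr-rows 10) (∑-cong 10 (λ h → cong (λ z → x h * x (10 ℕ.+ (c ℕ.+ h)) + x (10 ℕ.+ h) * x (20 ℕ.+ (c ℕ.+ h)) + x (20 ℕ.+ h) * z) (per (c ℕ.+ h))))

  corr₂ : corr 30 x (20 ℕ.+ c) ≡ ∑ 10 (λ h → x h * x (20 ℕ.+ (c ℕ.+ h)) + x (10 ℕ.+ h) * (ε * x (c ℕ.+ h)) + x (20 ℕ.+ h) * (ε * x (10 ℕ.+ (c ℕ.+ h))))
  corr₂ = trans (corr-rows 20) (∑-cong 10 (λ h → cong₂ (λ z w → x h * x (20 ℕ.+ (c ℕ.+ h)) + x (10 ℕ.+ h) * z + x (20 ℕ.+ h) * w) (per (c ℕ.+ h)) (per (10 ℕ.+ (c ℕ.+ h)))))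

corr-fold₃ : ∀ {ε} → ε * ε ≡ 1ℤ → ∀ x → (∀ h → x (30 ℕ.+ h) ≡ ε * x h) → ∀ c →
             corr 10 (fold₃ ε x) c ≡ corr 30 x c + ε * corr 30 x (10 ℕ.+ c) + corr 30 x (20 ℕ.+ c)
corr-fold₃ {ε} ε² x per c = begin
  ∑ 10 (λ h → fold₃ ε x h * fold₃ ε x (c ℕ.+ h))
    ≡⟨ ∑-cong 10 pointwise ⟩
  ∑ 10 (λ h → T₀ h + ε * T₁ h + T₂ h)
    ≡⟨ ∑-+ 10 (λ h → T₀ h + ε * T₁ h) T₂ ⟩
  ∑ 10 (λ h → T₀ h + ε * T₁ h) + ∑ 10 T₂
    ≡⟨ cong (_+ ∑ 10 T₂) (trans (∑-+ 10 T₀ (λ h → ε * T₁ h)) (cong (_+_ (∑ 10 T₀)) (∑-* 10 ε T₁))) ⟩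
  ∑ 10 T₀ + ε * ∑ 10 T₁ + ∑ 10 T₂
    ≡⟨ cong₂ _+_ (cong₂ (λ a b → a + ε * b) (sym corr₀) (sym corr₁)) (sym corr₂) ⟩
  corr 30 x c + ε * corr 30 x (10 ℕ.+ c) + corr 30 x (20 ℕ.+ c) ∎
  where
  open Rows {ε} x per c
  T₀ T₁ T₂ : ℕ → ℤ
  T₀ h = x h * x (c ℕ.+ h) + x (10 ℕ.+ h) * x (10 ℕ.+ (c ℕ.+ h)) + x (20 ℕ.+ h) * x (20 ℕ.+ (c ℕ.+ h))
  T₁ h = x h * x (10 ℕ.+ (c ℕ.+ h)) + x (10 ℕ.+ h) * x (20 ℕ.+ (c ℕ.+ h)) + x (20 ℕ.+ h) * (ε * x (c ℕ.+ h))
  T₂ h = x h * x (20 ℕ.+ (c ℕ.+ h)) + x (10 ℕ.+ h) * (ε * x (c ℕ.+ h)) + x (20 ℕ.+ h) * (ε * x (10 ℕ.+ (c ℕ.+ h)))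
  -- The last summand has the factor e² - 1 and vanishes once ε² = 1 is applied.
  expand : ∀ e x y z u v w → (x + e * y + z) * (u + e * v + w) ≡
           (x * u + y * v + z * w) + e * (x * v + y * w + z * (e * u)) + (x * w + y * (e * u) + z * (e * v))
           + (e * e - 1ℤ) * (y * v - z * u)
  expand = solve-∀
  pointwise : ∀ h → fold₃ ε x h * fold₃ ε x (c ℕ.+ h) ≡ T₀ h + ε * T₁ h + T₂ h
  pointwise h = trans (expand ε (x h) (x (10 ℕ.+ h)) (x (20 ℕ.+ h)) (x (c ℕ.+ h)) (x (10 ℕ.+ (c ℕ.+ h))) (x (20 ℕ.+ (c ℕ.+ h))))
    (trans (cong (λ s → T₀ h + ε * T₁ h + T₂ h + (s - 1ℤ) * d) ε²) (+-identityʳ (T₀ h + ε * T₁ h + T₂ h)))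
    where
    d = x (10 ℕ.+ h) * x (10 ℕ.+ (c ℕ.+ h)) - x (20 ℕ.+ h) * x (c ℕ.+ h)

-- Weighing elements as periodic sequences

record Weighing (f : ℕ → ℤ) : Set where
  field
    trit     : ∀ h → f h ≡ 0ℤ ⊎ f h ≡ 1ℤ ⊎ f h ≡ -1ℤ
    periodic : ∀ h → f (60 ℕ.+ h) ≡ f h
    corr-0   : corr 60 f 0 ≡ + 36
    corr-c   : ∀ c → 0 ℕ.< c → c ℕ.< 60 → corr 60 f c ≡ 0ℤ

corr-shift : ∀ f k c → (∀ h → f (60 ℕ.+ h) ≡ f h) → corr 60 (f ∘ (k ℕ.+_)) c ≡ corr 60 f c
corr-shift f k c per = trans (∑-cong 60 (λ h → cong (λ i → f (k ℕ.+ h) * f i) (+-swap k c h)))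
  (∑-rotate 60 k (λ h → f h * f (c ℕ.+ h)) (λ h → cong₂ _*_ (per h) (trans (cong f (+-swap c 60 h)) (per (c ℕ.+ h)))))

-- Translates of a solution are solutions; this later brings the constant row to index 0 and rotates
-- the rows.
shift : ∀ {f} k → Weighing f → Weighing (f ∘ (k ℕ.+_))
shift {f} k W = record
  { trit     = λ h → trit (k ℕ.+ h)
  ; periodic = λ h → trans (cong f (+-swap k 60 h)) (periodic (k ℕ.+ h))
  ; corr-0   = trans (corr-shift f k 0 periodic) corr-0
  ; corr-c   = λ c 0<c c<60 → trans (corr-shift f k c periodic) (corr-c c 0<c c<60)
  } where open Weighing W

unroll : GR → ℕ → ℤ
unroll S h = S (h mod 60)

-- Both sides are g - k; the right-hand form is the index reached by a shift of 60 - k. Decided over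
-- all pairs.
⊖-⊕ : ∀ g k → ⊖ ((⊖ g) ⊕ k) ≡ ((60 ℕ.∸ toℕ k) ℕ.+ toℕ g) mod 60
⊖-⊕ = toWitness {a? = Fin.all? (λ g → Fin.all? (λ k → (⊖ ((⊖ g) ⊕ k)) Fin.≟ (((60 ℕ.∸ toℕ k) ℕ.+ toℕ g) mod 60)))} tt

weighing : ∀ S → IsCW60-36 S → Weighing (unroll S)
weighing S (trit , auto) = record
  { trit     = λ h → trit (h mod 60)
  ; periodic = per
  -- At k = 0 `corr-·GR` speaks of the shift 60, not 0; periodicity identifies the two.
  ; corr-0   = trans (∑-cong 60 {λ h → unroll S h * unroll S h} (λ h → cong (unroll S h *_) (sym (per h)))) (trans (corr-·GR Fin.zero) (auto Fin.zero))
  ; corr-c   = λ c → corr-c c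
  }
  where
  per : ∀ h → unroll S (60 ℕ.+ h) ≡ unroll S h
  per h = cong S (Fin.toℕ-injective (trans (Fin.toℕ-fromℕ< _) (trans
    (trans (cong (ℕ._% 60) (ℕ.+-comm 60 h)) ([m+n]%n≡m%n h 60)) (sym (Fin.toℕ-fromℕ< _)))))
  corr-·GR : ∀ k → corr 60 (unroll S) (60 ℕ.∸ toℕ k) ≡ (S ·GR inv S) k
  corr-·GR k = sym (begin
    (S ·GR inv S) k
      ≡⟨ cong sumℤ (map-cong (λ g → cong (λ i → S g * S i) (⊖-⊕ g k)) (allFin 60)) ⟩
    sumℤ (map (λ g → S g * S (((60 ℕ.∸ toℕ k) ℕ.+ toℕ g) mod 60)) (allFin 60))
      ≡⟨ ∑-allFin (λ g h → S g * S (((60 ℕ.∸ toℕ k) ℕ.+ h) mod 60)) ⟩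
    corr 60 (unroll S) (60 ℕ.∸ toℕ k) ∎)
  constGR-suc : ∀ k {n} → toℕ k ≡ suc n → constGR (+ 36) k ≡ 0ℤ
  constGR-suc (Fin.suc k) eq = refl
  corr-c : ∀ c → 0 ℕ.< c → c ℕ.< 60 → corr 60 (unroll S) c ≡ 0ℤ
  corr-c (suc c) _ c<60 = begin
    corr 60 (unroll S) (suc c) ≡⟨ cong (λ i → corr 60 (unroll S) i) {suc c} {60 ℕ.∸ toℕ k} (sym 60∸k≡c) ⟩
    corr 60 (unroll S) (60 ℕ.∸ toℕ k) ≡⟨ corr-·GR k ⟩
    (S ·GR inv S) k ≡⟨ auto k ⟩
    constGR (+ 36) k ≡⟨ constGR-suc k (trans toℕ-k (ℕ.+-∸-assoc 1 (ℕ.≤-pred c<60))) ⟩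
    0ℤ ∎
    where
    k : Fin 60
    -- The coefficient at k is the autocorrelation at 60 - k, so k = 60 - (c + 1) gives the shift c
    -- + 1.
    k = Fin.fromℕ< {60 ℕ.∸ suc c} (s≤s (ℕ.m∸n≤m 59 c))
    toℕ-k : toℕ k ≡ 60 ℕ.∸ suc c
    toℕ-k = Fin.toℕ-fromℕ< _
    60∸k≡c : 60 ℕ.∸ toℕ k ≡ suc c
    60∸k≡c = trans (cong (60 ℕ.∸_) toℕ-k) (ℕ.m∸[m∸n]≡n (ℕ.<⇒≤ c<60))

-- Congruences and exhaustive search

infix 4 _≈_[mod_]

record _≈_[mod_] (x y : ℤ) (n : ℕ) : Set where
  constructor congruent
  field difference : + n ∣ x - y

≈-reflexive : ∀ {n x y} → x ≡ y → x ≈ y [mod n ]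
≈-reflexive {x = x} refl = congruent (divides 0ℤ (+-inverseʳ x))

≈-sym : ∀ {n x y} → x ≈ y [mod n ] → y ≈ x [mod n ]
≈-sym {n} {x} {y} (congruent (divides k eq)) =
  congruent (divides (- k) (trans (lemma x y) (trans (cong -_ eq) (neg-distribˡ-* k (+ n)))))
  where
  lemma : ∀ x y → y - x ≡ - (x - y)
  lemma = solve-∀

≈-trans : ∀ {n x y z} → x ≈ y [mod n ] → y ≈ z [mod n ] → x ≈ z [mod n ]
≈-trans {n} {x} {y} {z} (congruent p) (congruent q) = congruent (subst (+ n ∣_) (lemma x y z) (∣m∣n⇒∣m+n p q))
  where
  lemma : ∀ x y z → (x - y) + (y - z) ≡ x - z
  lemma = solve-∀

≈-+ : ∀ {n x y u v} → x ≈ y [mod n ] → u ≈ v [mod n ] → x + u ≈ y + v [mod n ]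
≈-+ {n} {x} {y} {u} {v} (congruent p) (congruent q) = congruent (subst (+ n ∣_) (lemma x y u v) (∣m∣n⇒∣m+n p q))
  where
  lemma : ∀ x y u v → (x - y) + (u - v) ≡ (x + u) - (y + v)
  lemma = solve-∀

≈-* : ∀ {n x y u v} → x ≈ y [mod n ] → u ≈ v [mod n ] → x * u ≈ y * v [mod n ]
≈-* {n} {x} {y} {u} {v} (congruent p) (congruent q) =
  congruent (subst (+ n ∣_) (lemma x y u v) (∣m∣n⇒∣m+n (∣m⇒∣m*n u p) (∣n⇒∣m*n y q)))
  where
  lemma : ∀ x y u v → (x - y) * u + y * (u - v) ≡ x * u - y * v
  lemma = solve-∀

%ℕ-≈ : ∀ x n .{{_ : NonZero n}} → + (x %ℕ n) ≈ x [mod n ]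
%ℕ-≈ x n = congruent (divides (- (x /ℕ n))
  (trans (cong (λ z → + (x %ℕ n) - z) (a≡a%ℕn+[a/ℕn]*n x n)) (lemma (+ (x %ℕ n)) (x /ℕ n) (+ n))))
  where
  lemma : ∀ r q n → r - (r + q * n) ≡ (- q) * n
  lemma = solve-∀

∣-resp-≈ : ∀ {n x y} → x ≈ y [mod n ] → + n ∣ y → + n ∣ x
∣-resp-≈ {n} {x} {y} (congruent p) q = subst (+ n ∣_) (lemma x y) (∣m∣n⇒∣m+n p q)
  where
  lemma : ∀ x y → (x - y) + y ≡ x
  lemma = solve-∀

%ℕ≡0⇒∣ : ∀ x n .{{_ : NonZero n}} → x %ℕ n ≡ 0 → + n ∣ x
%ℕ≡0⇒∣ x n eq = divides (x /ℕ n) (trans (a≡a%ℕn+[a/ℕn]*n x n) (trans (cong (λ r → + r + (x /ℕ n) * + n) eq) (+-identityˡ _)))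

-- Links the searches, which compute with lists of natural numbers, to integer sequences: the list
-- represents initial values modulo `n`.
data Reads (n : ℕ) : (ℕ → ℤ) → List ℕ → Set where
  []  : ∀ {F} → Reads n F []
  _∷_ : ∀ {F y ys} → + y ≈ F 0 [mod n ] → Reads n (F ∘ suc) ys → Reads n F (y ∷ ys)

Reads-++ : ∀ {n F xs ys} → Reads n F xs → Reads n (λ h → F (length xs ℕ.+ h)) ys → Reads n F (xs ++ ys)
Reads-++ []       q = q
Reads-++ (p ∷ ps) q = p ∷ Reads-++ ps q

Reads-map : ∀ {n F G e ε xs} → + e ≈ ε [mod n ] → (∀ h → G h ≈ ε * F h [mod n ]) → Reads n F xs → Reads n G (map (e ℕ.*_) xs)
Reads-map e≈ε eq [] = []
Reads-map {n} {F} {G} {e} {ε} {x ∷ xs} e≈ε eq (p ∷ ps) =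
  ≈-trans (≈-reflexive (pos-* e x)) (≈-trans (≈-* e≈ε p) (≈-sym (eq 0)))
  ∷ Reads-map e≈ε (eq ∘ suc) ps

Reads-applyUpTo : ∀ {n F d} m → (∀ h → (+ d h) ≈ F h [mod n ]) → Reads n F (applyUpTo d m)
Reads-applyUpTo zero    eq = []
Reads-applyUpTo (suc m) eq = eq 0 ∷ Reads-applyUpTo m (eq ∘ suc)

dot : List ℕ → List ℕ → ℕ
dot (x ∷ xs) (y ∷ ys) = x ℕ.* y ℕ.+ dot xs ys
dot _        _        = 0

dot-≈ : ∀ {n F G xs ys} → Reads n F xs → Reads n G ys → length xs ℕ.≤ length ys →
          + dot xs ys ≈ ∑ (length xs) (λ h → F h * G h) [mod n ]
dot-≈ {F = F} {G} [] q le = ≈-reflexive (sym (∑-zero (λ h → F h * G h)))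
dot-≈ {F = F} {G} {x ∷ xs} {y ∷ ys} (p ∷ ps) (q ∷ qs) (s≤s le) =
  ≈-trans (≈-reflexive (cong (_+ + dot xs ys) (pos-* x y)))
    (≈-trans (≈-+ (≈-* p q) (dot-≈ ps qs le)) (≈-reflexive (sym (∑-suc (length xs) (λ h → F h * G h)))))

-- In use, `w` is `v` followed by its continuation. Dropping a head before each `dot` tests the
-- shifts 1, 2, ... in turn, and the first failure ends the test.
uncorrelated : ℕ → List ℕ → List ℕ → (n : ℕ) .{{_ : NonZero n}} → Bool
uncorrelated zero    v w       n = true
uncorrelated (suc k) v []      n = true
uncorrelated (suc k) v (_ ∷ w) n = if (dot v w ℕ.% n) ≡ᵇ 0 then uncorrelated k v w n else false

uncorrelated-true : ∀ {n} .{{_ : NonZero n}} {F G v} k {w} → Reads n F v → Reads n G w → k ℕ.+ length v ℕ.≤ length w →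
  (∀ c → 0 ℕ.< c → c ℕ.≤ k → + n ∣ ∑ (length v) (λ h → F h * G (c ℕ.+ h))) → uncorrelated k v w n ≡ true
uncorrelated-true zero    _ _  _  _ = refl
uncorrelated-true (suc k) p [] le _ = refl
uncorrelated-true {n} {F} {G} {v} (suc k) {y ∷ w} p (q ∷ qs) (s≤s le) orth
  rewrite ℕ.n∣m⇒m%n≡0 (dot v w) n (∣⇒∣ᵤ (∣-resp-≈ (dot-≈ p qs (ℕ.≤-trans (ℕ.m≤n+m _ k) le)) (orth 1 (s≤s z≤n) (s≤s z≤n)))) =
  uncorrelated-true k p qs le (λ c 0<c c≤k → orth (suc c) (s≤s z≤n) (s≤s c≤k))

-- Only the shifts 1, …, k are tested; e represents the sign ε modulo n.
autocorrelated : (n : ℕ) .{{_ : NonZero n}} → ℕ → ℕ → List ℕ → Bool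
autocorrelated n e k v = uncorrelated k v (v ++ map (e ℕ.*_) v) n

autocorrelated-true : ∀ n .{{_ : NonZero n}} e k {ε F v} → + e ≈ ε [mod n ] → Reads n F v →
  (∀ h → F (length v ℕ.+ h) ≈ ε * F h [mod n ]) → k ℕ.≤ length v →
  (∀ c → 0 ℕ.< c → c ℕ.≤ k → + n ∣ corr (length v) F c) → autocorrelated n e k v ≡ true
autocorrelated-true n e k {ε} {F} {v} e≡ε p per k≤ orth =
  uncorrelated-true k p (Reads-++ p (Reads-map {ε = ε} e≡ε per p))
    (subst (k ℕ.+ length v ℕ.≤_) (sym (trans (length-++ v) (cong (length v ℕ.+_) (length-map (e ℕ.*_) v)))) (ℕ.+-monoˡ-≤ (length v) k≤)) orth

isotropic : (n : ℕ) .{{_ : NonZero n}} → ℕ → ℕ → List ℕ → Bool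
isotropic n e k v = ((dot v v ℕ.% n) ≡ᵇ 0) ∧ autocorrelated n e k v

isotropic-true : ∀ n .{{_ : NonZero n}} e k {ε F v} → + e ≈ ε [mod n ] → Reads n F v →
  (∀ h → F (length v ℕ.+ h) ≈ ε * F h [mod n ]) → k ℕ.≤ length v →
  (∀ c → c ℕ.≤ k → + n ∣ corr (length v) F c) → isotropic n e k v ≡ true
isotropic-true n e k {v = v} e≈ε p per k≤ orth
  rewrite ℕ.n∣m⇒m%n≡0 (dot v v) n (∣⇒∣ᵤ (∣-resp-≈ (dot-≈ p p ℕ.≤-refl) (orth 0 z≤n))) =
  autocorrelated-true n e k e≈ε p per k≤ (λ c _ → orth c)

-- Asserts the test for every choice of one candidate per list with total weight exactly `b`.
-- Branches that exceed the budget are pruned, and choices that fall short of it count as passed.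
-- Weights 0 with budget 0 give an unpruned search.
search : {A : Set} → List (List (ℕ × A)) → ℕ → (List A → Bool) → Bool
searchHead : {A : Set} → List (ℕ × A) → List (List (ℕ × A)) → ℕ → (List A → Bool) → Bool
search []         zero    test = test []
search []         (suc b) test = true
search (cs ∷ css) b       test = searchHead cs css b test
searchHead []             css b test = true
searchHead ((w , c) ∷ cs) css b test =
  (if w ≤ᵇ b then search css (b ℕ.∸ w) (λ xs → test (c ∷ xs)) else true) ∧ searchHead cs css b test

∑ℕ : ℕ → (ℕ → ℕ) → ℕ
∑ℕ zero    w = 0
∑ℕ (suc n) w = w 0 ℕ.+ ∑ℕ n (w ∘ suc)

∧-true : ∀ {x y} → x ∧ y ≡ true → x ≡ true × y ≡ true
∧-true {true} {true} refl = refl , refl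

≤ᵇ-true : ∀ {m n} → m ℕ.≤ n → (m ≤ᵇ n) ≡ true
≤ᵇ-true m≤n = Equivalence.to T-≡ (ℕ.≤⇒≤ᵇ m≤n)

search-sound : {A : Set} (n : ℕ) (css : ℕ → List (ℕ × A)) {b : ℕ} {test : List A → Bool} (w : ℕ → ℕ) (c : ℕ → A) →
  (∀ m → m ℕ.< n → (w m , c m) ∈ css m) → ∑ℕ n w ≡ b →
  search (applyUpTo css n) b test ≡ true → test (applyUpTo c n) ≡ true
search-sound zero    css w c mem refl ok = ok
search-sound (suc n) css {b} {test} w c mem eq ok = go (css 0) (mem 0 (s≤s z≤n)) ok
  where
  go : ∀ cs → (w 0 , c 0) ∈ cs → searchHead cs (applyUpTo (css ∘ suc) n) b test ≡ true → test (applyUpTo c (suc n)) ≡ true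
  go (_ ∷ cs) (there i) ok = go cs i (proj₂ (∧-true ok))
  go (_ ∷ cs) (here refl) ok =
    search-sound n (css ∘ suc) (w ∘ suc) (c ∘ suc) (λ m m<n → mem (suc m) (s≤s m<n))
      (trans (sym (ℕ.m+n∸m≡n (w 0) _)) (cong (ℕ._∸ w 0) eq))
      -- The weight of the actual head is at most the budget, so its branch was not pruned.
      (trans (cong (λ x → if x then search (applyUpTo (css ∘ suc) n) (b ℕ.∸ w 0) (λ xs → test (c 0 ∷ xs)) else true)
               (sym (≤ᵇ-true (subst (w 0 ℕ.≤_) eq (ℕ.m≤m+n (w 0) (∑ℕ n (w ∘ suc)))))))
             (proj₁ (∧-true ok)))

all-applyUpTo : ∀ {A : Set} (p : A → Bool) c n → all p (applyUpTo c n) ≡ true → ∀ m → m ℕ.< n → p (c m) ≡ true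
all-applyUpTo p c (suc n) ok zero    _         = proj₁ (∧-true ok)
all-applyUpTo p c (suc n) ok (suc m) (s≤s m<n) = all-applyUpTo p (c ∘ suc) n (proj₂ (∧-true ok)) m m<n

≡ᵇ0 : ∀ n → (n ≡ᵇ 0) ≡ true → n ≡ 0
≡ᵇ0 zero _ = refl

-- The second argument, often a further search, is evaluated only when the first is true.
_implies_ : Bool → Bool → Bool
x implies y = if x then y else true

modus-ponens : ∀ {x y} → x implies y ≡ true → x ≡ true → y ≡ true
modus-ponens ok refl = ok

-- Searches at the primes 3 and 2

digits₃ : List (ℕ × ℕ)
digits₃ = (0 , 0) ∷ (0 , 1) ∷ (0 , 2) ∷ []

∈-digits₃ : ∀ {d} → d ℕ.< 3 → (0 , d) ∈ digits₃
∈-digits₃ {0} _ = here refl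
∈-digits₃ {1} _ = there (here refl)
∈-digits₃ {2} _ = there (there (here refl))
∈-digits₃ {suc (suc (suc d))} (s≤s (s≤s (s≤s ())))

-- Shifts up to 5 suffice, since a cyclic autocorrelation of period 10 takes the same value at c and
-- 10 - c.
vanish₃ : List ℕ → Bool
vanish₃ xs = isotropic 3 1 5 xs implies all (_≡ᵇ 0) xs

-- x ↦ x x* is anisotropic on 𝔽₃[C₁₀], because −1 is a power of 3 modulo 10.
search-vanish₃ : search (applyUpTo (λ _ → digits₃) 10) 0 vanish₃ ≡ true
search-vanish₃ = refl

∑ℕ-0 : ∀ n → ∑ℕ n (λ _ → 0) ≡ 0
∑ℕ-0 zero    = refl
∑ℕ-0 (suc n) = ∑ℕ-0 n

-- Applied twice: to the row sums of q, and then to differences within its rows.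
mod-3-vanishing : ∀ F → (∀ h → F (10 ℕ.+ h) ≈ 1ℤ * F h [mod 3 ]) →
  (∀ c → c ℕ.≤ 5 → + 3 ∣ corr 10 F c) → ∀ m → m ℕ.< 10 → F m %ℕ 3 ≡ 0
mod-3-vanishing F per orth m m<10 =
  ≡ᵇ0 (F m %ℕ 3) (all-applyUpTo (_≡ᵇ 0) d 10 (modus-ponens {isotropic 3 1 5 (applyUpTo d 10)} found
    (isotropic-true 3 1 5 {1ℤ} {F} (≈-reflexive refl) (Reads-applyUpTo 10 (λ h → %ℕ-≈ (F h) 3)) per (ℕ.m≤m+n 5 5) orth)) m m<10)
  where
  d : ℕ → ℕ
  d h = F h %ℕ 3
  found : vanish₃ (applyUpTo d 10) ≡ true
  found = search-sound 10 (λ _ → digits₃) {test = vanish₃} (λ _ → 0) d (λ h _ → ∈-digits₃ (n%ℕd<d (F h) 3)) (∑ℕ-0 10) search-vanish₃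

digits₂ : List (ℕ × ℕ)
digits₂ = (0 , 0) ∷ (0 , 1) ∷ []

lifts₄ : ℕ → List (ℕ × ℕ)
lifts₄ d = (0 , d) ∷ (0 , 2 ℕ.+ d) ∷ []

even : ℕ → Bool
even d = (d ℕ.% 2) ≡ᵇ 0

allEven : List ℕ → Bool
allEven xs = isotropic 4 3 9 xs implies all even xs

-- Modulo 2 the polynomial x¹⁰ + 1 is the square of x⁵ + 1, so isotropy there does not force
-- vanishing. Only the survivors modulo 2 are lifted to residues modulo 4, which avoids running
-- through all 4¹⁰ lists.
liftsEven : List ℕ → Bool
liftsEven xs = isotropic 2 1 9 xs implies search (map lifts₄ xs) 0 allEven

-- The prime above 2 of ℤ[i] ramifies and is self-conjugate in ℤ[ζ₂₀].
search-even : search (applyUpTo (λ _ → digits₂) 10) 0 liftsEven ≡ true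
search-even = refl

∣2∣4 : ∀ {x} → + 4 ∣ x → + 2 ∣ x
∣2∣4 (divides k eq) = divides (k * + 2) (trans eq (sym (*-assoc k (+ 2) (+ 2))))

negacyclic-even : ∀ F → (∀ h → F (10 ℕ.+ h) ≡ -1ℤ * F h) →
  (∀ c → c ℕ.≤ 9 → + 4 ∣ corr 10 F c) → ∀ m → m ℕ.< 10 → (F m %ℕ 4) ℕ.% 2 ≡ 0
negacyclic-even F per orth m m<10 = ≡ᵇ0 _ (all-applyUpTo even d 10 (modus-ponens {isotropic 4 3 9 (applyUpTo d 10)} found₄
    (isotropic-true 4 3 9 { -1ℤ} {F} (congruent (divides 1ℤ refl)) (Reads-applyUpTo 10 (λ h → %ℕ-≈ (F h) 4)) (λ h → ≈-reflexive (per h)) (ℕ.m≤m+n 9 1) orth)) m m<10)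
  where
  d bit : ℕ → ℕ
  d h = F h %ℕ 4
  bit h = d h ℕ.% 2
  mod-2 : ∀ {x y} → x ≈ y [mod 4 ] → x ≈ y [mod 2 ]
  mod-2 (congruent p) = congruent (∣2∣4 p)
  bit≈F : ∀ h → + bit h ≈ F h [mod 2 ]
  bit≈F h = ≈-trans (%ℕ-≈ (+ d h) 2) (mod-2 (%ℕ-≈ (F h) 4))
  ∈-digits₂ : ∀ {d} → d ℕ.< 4 → (0 , d ℕ.% 2) ∈ digits₂
  ∈-digits₂ {0} _ = here refl
  ∈-digits₂ {1} _ = there (here refl)
  ∈-digits₂ {2} _ = here refl
  ∈-digits₂ {3} _ = there (here refl)
  ∈-digits₂ {suc (suc (suc (suc d)))} (s≤s (s≤s (s≤s (s≤s ()))))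
  ∈-lifts₄ : ∀ {d} → d ℕ.< 4 → (0 , d) ∈ lifts₄ (d ℕ.% 2)
  ∈-lifts₄ {0} _ = here refl
  ∈-lifts₄ {1} _ = here refl
  ∈-lifts₄ {2} _ = there (here refl)
  ∈-lifts₄ {3} _ = there (here refl)
  ∈-lifts₄ {suc (suc (suc (suc d)))} (s≤s (s≤s (s≤s (s≤s ()))))
  found₂ : liftsEven (applyUpTo bit 10) ≡ true
  found₂ = search-sound 10 (λ _ → digits₂) {test = liftsEven} (λ _ → 0) bit (λ h _ → ∈-digits₂ (n%ℕd<d (F h) 4)) (∑ℕ-0 10) search-even
  found₄ : allEven (applyUpTo d 10) ≡ true
  found₄ = search-sound 10 (lifts₄ ∘ bit) {test = allEven} (λ _ → 0) d (λ h _ → ∈-lifts₄ (n%ℕd<d (F h) 4)) (∑ℕ-0 10)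
    (modus-ponens {isotropic 2 1 9 (applyUpTo bit 10)} found₂
      (isotropic-true 2 1 9 { -1ℤ} {F} (congruent (divides 1ℤ refl)) (Reads-applyUpTo 10 bit≈F) (λ h → ≈-reflexive (per h)) (ℕ.m≤m+n 9 1)
        (λ c c≤9 → ∣2∣4 (orth c c≤9))))

-- The shape of the rows

Row : Set
Row = ℕ × ℕ × ℕ

-- A row holds the entries at m, 10 + m and 20 + m; for ten rows this restores the order of the
-- indices 0 to 29.
flat : List Row → List ℕ
flat rs = map proj₁ rs ++ map (λ r → proj₁ (proj₂ r)) rs ++ map (λ r → proj₂ (proj₂ r)) rs

residues : (n : ℕ) .{{_ : ℕ.NonZero n}} → ℤ → ℤ → ℤ → Row
residues n x y z = x %ℕ n , y %ℕ n , z %ℕ n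

-- The position of the entry ±2 in a row ±(1, 1, −2) (up to order), or 0 for a zero row.
hole : ℤ → ℤ → ℤ → ℕ
hole x y z = if ∣ x ∣ ≡ᵇ 2 then 1 else if ∣ y ∣ ≡ᵇ 2 then 2 else if ∣ z ∣ ≡ᵇ 2 then 3 else 0

occupied : ℕ → ℕ
occupied zero    = 0
occupied (suc _) = 1

-- The hole after a row (x, y, z) becomes (z, x, y).
rotate : ℕ → ℕ
rotate 0 = 0
rotate 1 = 2
rotate 2 = 3
rotate _ = 1

holes : List (ℕ × ℕ)
holes = (0 , 0) ∷ (1 , 1) ∷ (1 , 2) ∷ (1 , 3) ∷ []

-- As |q| + |a| ≤ 2, a vanishes where q is ±2; it is odd where q is ±1, and even along a zero row of
-- q.
parities : ℕ → Row
parities 0 = 0 , 0 , 0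
parities 1 = 0 , 1 , 1
parities 2 = 1 , 0 , 1
parities _ = 1 , 1 , 0

evens : List (ℕ × ℕ)
evens = (0 , 0) ∷ (4 , 2) ∷ (4 , 62) ∷ (16 , 4) ∷ (16 , 60) ∷ (36 , 6) ∷ (36 , 58) ∷ []

-- Classifies the residue modulo 64 of a row sum of a as 0, 2, −2, ±6 or ±4.
sumClass : ℕ → ℕ
sumClass d = if d ≡ᵇ 0 then 0 else if d ≡ᵇ 2 then 1 else if d ≡ᵇ 62 then 2
             else if (d ≡ᵇ 6) ∨ (d ≡ᵇ 58) then 3 else 4

-- The rows of a modulo 4, weighted by their norms, for a given hole and class of the row sum. The
-- middle entry enters this sum with a minus sign, because a is negacyclic.
rows₄ : ℕ → ℕ → List (ℕ × Row)
rows₄ 0 0 = (0 , 0 , 0 , 0) ∷ (8 , 0 , 2 , 2) ∷ (8 , 2 , 0 , 2) ∷ (8 , 2 , 2 , 0) ∷ []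
rows₄ 0 3 = (12 , 2 , 2 , 2) ∷ []
rows₄ 0 4 = (8 , 0 , 2 , 2) ∷ (8 , 2 , 0 , 2) ∷ (8 , 2 , 2 , 0) ∷ []
rows₄ 0 _ = (4 , 2 , 0 , 0) ∷ (4 , 0 , 2 , 0) ∷ (4 , 0 , 0 , 2) ∷ (12 , 2 , 2 , 2) ∷ []
rows₄ 1 0 = (2 , 0 , 1 , 1) ∷ (2 , 0 , 3 , 3) ∷ []
rows₄ 1 1 = (2 , 0 , 3 , 1) ∷ []
rows₄ 1 2 = (2 , 0 , 1 , 3) ∷ []
rows₄ 2 0 = (2 , 1 , 0 , 3) ∷ (2 , 3 , 0 , 1) ∷ []
rows₄ 2 1 = (2 , 1 , 0 , 1) ∷ []
rows₄ 2 2 = (2 , 3 , 0 , 3) ∷ []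
rows₄ 3 0 = (2 , 1 , 1 , 0) ∷ (2 , 3 , 3 , 0) ∷ []
rows₄ 3 1 = (2 , 1 , 3 , 0) ∷ []
rows₄ 3 2 = (2 , 3 , 1 , 0) ∷ []
rows₄ _ _ = []

-- Entries of a lie between -2 and 2, so only the residue 2 modulo 4 leaves a choice, that of the
-- sign; 126 and 127 stand for -2 and -1.
lift : ℕ → List ℕ
lift 2 = 2 ∷ 126 ∷ []
lift 3 = 127 ∷ []
lift d = d ∷ []

liftRow : Row → List (ℕ × Row)
liftRow (x , y , z) = concatMap (λ x′ → concatMap (λ y′ → map (λ z′ → 0 , x′ , y′ , z′) (lift z)) (lift y)) (lift x)

Trit : ℤ → Set
Trit x = x ≡ 0ℤ ⊎ x ≡ 1ℤ ⊎ x ≡ -1ℤ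

trits? : {P : ℤ → Set} → (∀ x → Dec (P x)) → Dec (∀ x → Trit x → P x)
trits? {P} P? = map′ to (λ p → p 0ℤ (inj₁ refl) , p 1ℤ (inj₂ (inj₁ refl)) , p -1ℤ (inj₂ (inj₂ refl)))
                     (P? 0ℤ ×-dec (P? 1ℤ ×-dec P? -1ℤ))
  where
  to : P 0ℤ × P 1ℤ × P -1ℤ → ∀ x → Trit x → P x
  to (p , _ , _) _ (inj₁ refl)        = p
  to (_ , p , _) _ (inj₂ (inj₁ refl)) = p
  to (_ , _ , p) _ (inj₂ (inj₂ refl)) = p

-- The terms have the shape of fold₂ and fold₃ at an index, so that they agree with those by conversion.
module RowOf (s₀ s₁ s₂ s₃ s₄ s₅ : ℤ) where

  q₀ q₁ q₂ a₀ a₁ a₂ t b : ℤ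
  q₀ = s₀ + 1ℤ * s₃
  q₁ = s₁ + 1ℤ * s₄
  q₂ = s₂ + 1ℤ * s₅
  a₀ = s₀ + -1ℤ * s₃
  a₁ = s₁ + -1ℤ * s₄
  a₂ = s₂ + -1ℤ * s₅
  t  = q₀ + 1ℤ * q₁ + q₂
  b  = a₀ + -1ℤ * a₁ + a₂

  p c norm : ℕ
  p    = hole q₀ q₁ q₂
  c    = sumClass (b %ℕ 64)
  norm = ∣ a₀ * a₀ + a₁ * a₁ + a₂ * a₂ ∣

  record Constant : Set where
    constructor constant
    field
      t²≡36   : t * t ≡ + 36
      a₀≡0    : a₀ ≡ 0ℤ
      a₁≡0    : a₁ ≡ 0ℤ
      a₂≡0    : a₂ ≡ 0ℤ
      q-norm  : q₀ * q₀ + q₁ * q₁ + q₂ * q₂ ≡ + 12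

  -- The memberships are those that `search-sound` asks for. In `q-norm`, 6 is the norm of ±(1, 1,
  -- -2).
  record Balanced : Set where
    constructor balanced
    field
      t≡0      : t ≡ 0ℤ
      q-norm   : q₀ * q₀ + q₁ * q₁ + q₂ * q₂ ≡ + (6 ℕ.* occupied p)
      hole-∈   : (occupied p , p) ∈ holes
      rotated  : hole q₂ q₀ q₁ ≡ rotate p
      parity   : residues 2 a₀ a₁ a₂ ≡ parities p
      row-∈    : (norm , residues 4 a₀ a₁ a₂) ∈ rows₄ p c
      lift-∈   : (0 , residues 128 a₀ a₁ a₂) ∈ liftRow (residues 4 a₀ a₁ a₂)
      even-∈   : (∣ b * b ∣ , b %ℕ 64) ∈ evens

  Dichotomy : Set
  Dichotomy = (b %ℕ 4) ℕ.% 2 ≡ 0 → t %ℕ 3 ≡ 0 → (q₀ - q₁) %ℕ 3 ≡ 0 → Constant ⊎ Balanced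

  private
    _≟ᵣ_ = ×.≡-dec ℕ._≟_ (×.≡-dec ℕ._≟_ ℕ._≟_)
    open DecMembership (×.≡-dec ℕ._≟_ _≟ᵣ_) using () renaming (_∈?_ to _∈ᵣ?_)
    open DecMembership (×.≡-dec ℕ._≟_ ℕ._≟_) using () renaming (_∈?_ to _∈ₙ?_)

  constant? : Dec Constant
  constant? = map′ (λ (t² , x , y , z , n) → constant t² x y z n) (λ (constant t² x y z n) → t² , x , y , z , n)
    (t * t ℤ.≟ + 36 ×-dec a₀ ℤ.≟ 0ℤ ×-dec a₁ ℤ.≟ 0ℤ ×-dec a₂ ℤ.≟ 0ℤ ×-dec q₀ * q₀ + q₁ * q₁ + q₂ * q₂ ℤ.≟ + 12)

  balanced? : Dec Balanced
  balanced? = map′ (λ (z , n , h , ρ , π , r , l , e) → balanced z n h ρ π r l e) (λ (balanced z n h ρ π r l e) → z , n , h , ρ , π , r , l , e)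
    (t ℤ.≟ 0ℤ ×-dec q₀ * q₀ + q₁ * q₁ + q₂ * q₂ ℤ.≟ + (6 ℕ.* occupied p) ×-dec (occupied p , p) ∈ₙ? holes
     ×-dec hole q₂ q₀ q₁ ℕ.≟ rotate p ×-dec residues 2 a₀ a₁ a₂ ≟ᵣ parities p
     ×-dec (norm , residues 4 a₀ a₁ a₂) ∈ᵣ? rows₄ p c
     ×-dec (0 , residues 128 a₀ a₁ a₂) ∈ᵣ? liftRow (residues 4 a₀ a₁ a₂)
     ×-dec (∣ b * b ∣ , b %ℕ 64) ∈ₙ? evens)

  dichotomy? : Dec Dichotomy
  dichotomy? = (b %ℕ 4) ℕ.% 2 ℕ.≟ 0 →-dec t %ℕ 3 ℕ.≟ 0 →-dec (q₀ - q₁) %ℕ 3 ℕ.≟ 0 →-dec (constant? ⊎-dec balanced?)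

-- Decided on all 3⁶ inputs. The reason: `t` is divisible by 6, being congruent to `b` modulo 2, and
-- q is constant modulo 3 because `q₂` ≡ -`q₀` - `q₁` ≡ `q₀`. With |q| ≤ 2 this leaves rows of sum 0
-- and ±(2, 2, 2).
dichotomy : ∀ s₀ → Trit s₀ → ∀ s₁ → Trit s₁ → ∀ s₂ → Trit s₂ → ∀ s₃ → Trit s₃ → ∀ s₄ → Trit s₄ → ∀ s₅ → Trit s₅ →
            RowOf.Dichotomy s₀ s₁ s₂ s₃ s₄ s₅
dichotomy = toWitness {a? = trits? λ s₀ → trits? λ s₁ → trits? λ s₂ → trits? λ s₃ → trits? λ s₄ → trits? λ s₅ →
            RowOf.dichotomy? s₀ s₁ s₂ s₃ s₄ s₅} tt

-- An autocorrelation identity for rows with sums divisible by 3: the second step of the descent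
-- at the prime 1 − ω above 3 in ℤ[ω].
module _ (x : ℕ → ℤ) (per : ∀ h → x (30 ℕ.+ h) ≡ 1ℤ * x h)
         (u : ℕ → ℤ) (sum : ∀ h → fold₃ 1ℤ x h ≡ u h * + 3) where

  step : ℕ → ℤ
  step h = x h - x (10 ℕ.+ h)

  private
    last : ∀ h → x (20 ℕ.+ h) ≡ u h * + 3 - (x h + x (10 ℕ.+ h))
    last h = trans (lemma (x h) (x (10 ℕ.+ h)) (x (20 ℕ.+ h))) (cong (_- (x h + x (10 ℕ.+ h))) (sum h))
      where
      lemma : ∀ x y z → z ≡ (x + 1ℤ * y + z) - (x + y)
      lemma = solve-∀

  -- For a row (x, y, z) with sum divisible by 3, y - z ≡ x + 2y ≡ x - y modulo 3.
  step-periodic : ∀ h → step (10 ℕ.+ h) ≈ 1ℤ * step h [mod 3 ]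
  step-periodic h = congruent (divides (x (10 ℕ.+ h) - u h)
    (trans (cong (λ z → (x (10 ℕ.+ h) - z) - 1ℤ * (x h - x (10 ℕ.+ h))) (last h)) (lemma (x h) (x (10 ℕ.+ h)) (u h))))
    where
    lemma : ∀ x y u → (y - (u * + 3 - (x + y))) - 1ℤ * (x - y) ≡ (y - u) * + 3
    lemma = solve-∀

  -- The left-hand combination is the trace from ℚ(ω) to ℚ of the correlation after x¹⁰ ↦ ω.
  -- Eliminating the third entry of each row turns it into 6A + 9B, so 2A + 3B = 3k and 3 divides A.
  step-corr : ∀ c k → + 2 * corr 30 x c - corr 30 x (10 ℕ.+ c) - corr 30 x (20 ℕ.+ c) ≡ k * + 9 → + 3 ∣ corr 10 step c
  step-corr c k eq = divides (A + B - k) (combine A B k (*-cancelˡ-≡ (+ 3) (+ 2 * A + + 3 * B) (k * + 3) (begin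
    + 3 * (+ 2 * A + + 3 * B)           ≡⟨ lemma₁ A B ⟩
    + 6 * A + + 9 * B                   ≡⟨ sym (cong₂ _+_ (∑-* 10 (+ 6) E) (∑-* 10 (+ 9) W)) ⟩
    ∑ 10 (λ h → + 6 * E h) + ∑ 10 (λ h → + 9 * W h) ≡⟨ sym (∑-+ 10 (λ h → + 6 * E h) (λ h → + 9 * W h)) ⟩
    ∑ 10 (λ h → + 6 * E h + + 9 * W h)  ≡⟨ sym (∑-cong 10 pointwise) ⟩
    ∑ 10 (λ h → + 2 * T₀ h + -1ℤ * (T₁ h + T₂ h)) ≡⟨ ∑-+ 10 (λ h → + 2 * T₀ h) (λ h → -1ℤ * (T₁ h + T₂ h)) ⟩
    ∑ 10 (λ h → + 2 * T₀ h) + ∑ 10 (λ h → -1ℤ * (T₁ h + T₂ h))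
      ≡⟨ cong₂ _+_ (∑-* 10 (+ 2) T₀) (trans (∑-* 10 -1ℤ (λ h → T₁ h + T₂ h)) (cong (-1ℤ *_) (∑-+ 10 T₁ T₂))) ⟩
    + 2 * ∑ 10 T₀ + -1ℤ * (∑ 10 T₁ + ∑ 10 T₂) ≡⟨ lemma₂ (∑ 10 T₀) (∑ 10 T₁) (∑ 10 T₂) ⟩
    + 2 * ∑ 10 T₀ - ∑ 10 T₁ - ∑ 10 T₂   ≡⟨ cong₂ _-_ (cong₂ (λ a b → + 2 * a - b) (sym corr₀) (sym corr₁)) (sym corr₂) ⟩
    + 2 * corr 30 x c - corr 30 x (10 ℕ.+ c) - corr 30 x (20 ℕ.+ c) ≡⟨ eq ⟩
    k * + 9                             ≡⟨ lemma₃ k ⟩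
    + 3 * (k * + 3)                     ∎)))
    where
    open Rows {1ℤ} x per c
    T₀ T₁ T₂ E W : ℕ → ℤ
    T₀ h = x h * x (c ℕ.+ h) + x (10 ℕ.+ h) * x (10 ℕ.+ (c ℕ.+ h)) + x (20 ℕ.+ h) * x (20 ℕ.+ (c ℕ.+ h))
    T₁ h = x h * x (10 ℕ.+ (c ℕ.+ h)) + x (10 ℕ.+ h) * x (20 ℕ.+ (c ℕ.+ h)) + x (20 ℕ.+ h) * (1ℤ * x (c ℕ.+ h))
    T₂ h = x h * x (20 ℕ.+ (c ℕ.+ h)) + x (10 ℕ.+ h) * (1ℤ * x (c ℕ.+ h)) + x (20 ℕ.+ h) * (1ℤ * x (10 ℕ.+ (c ℕ.+ h)))
    E h = step h * step (c ℕ.+ h)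
    W h = step h * (x (10 ℕ.+ (c ℕ.+ h)) - u (c ℕ.+ h)) + (x (10 ℕ.+ h) - u h) * step (c ℕ.+ h)
          + + 2 * (x (10 ℕ.+ h) - u h) * (x (10 ℕ.+ (c ℕ.+ h)) - u (c ℕ.+ h))
    A B : ℤ
    A = corr 10 step c
    B = ∑ 10 W
    lemma₁ : ∀ a b → + 3 * (+ 2 * a + + 3 * b) ≡ + 6 * a + + 9 * b
    lemma₁ = solve-∀
    lemma₂ : ∀ a b c → + 2 * a + -1ℤ * (b + c) ≡ + 2 * a - b - c
    lemma₂ = solve-∀
    lemma₃ : ∀ k → k * + 9 ≡ + 3 * (k * + 3)
    lemma₃ = solve-∀
    combine : ∀ a b k → + 2 * a + + 3 * b ≡ k * + 3 → a ≡ (a + b - k) * + 3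
    combine a b k eq = trans (lemma₄ a b) (trans (cong (λ z → + 3 * a + + 3 * b - z) eq) (lemma₅ a b k))
      where
      lemma₄ : ∀ a b → a ≡ + 3 * a + + 3 * b - (+ 2 * a + + 3 * b)
      lemma₄ = solve-∀
      lemma₅ : ∀ a b k → + 3 * a + + 3 * b - k * + 3 ≡ (a + b - k) * + 3
      lemma₅ = solve-∀
    expand : ∀ x y u x′ y′ u′ →
      + 2 * (x * x′ + y * y′ + (u * + 3 - (x + y)) * (u′ * + 3 - (x′ + y′)))
        + -1ℤ * ((x * y′ + y * (u′ * + 3 - (x′ + y′)) + (u * + 3 - (x + y)) * (1ℤ * x′))
               + (x * (u′ * + 3 - (x′ + y′)) + y * (1ℤ * x′) + (u * + 3 - (x + y)) * (1ℤ * y′)))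
      ≡ + 6 * ((x - y) * (x′ - y′)) + + 9 * ((x - y) * (y′ - u′) + (y - u) * (x′ - y′) + + 2 * (y - u) * (y′ - u′))
    expand = solve-∀
    pointwise : ∀ h → + 2 * T₀ h + -1ℤ * (T₁ h + T₂ h) ≡ + 6 * E h + + 9 * W h
    pointwise h rewrite last h | last (c ℕ.+ h) =
      expand (x h) (x (10 ℕ.+ h)) (u h) (x (c ℕ.+ h)) (x (10 ℕ.+ (c ℕ.+ h))) (u (c ℕ.+ h))

-- Divisibility properties of the folds

by-period : ∀ {P : ℕ → Set} → (∀ m → m ℕ.< 10 → P m) → (∀ m → P m → P (10 ℕ.+ m)) → ∀ m → P m
by-period {P} base ind m = subst P (trans (ℕ.+-comm (m ℕ./ 10 ℕ.* 10) (m ℕ.% 10)) (sym (m≡m%n+[m/n]*n m 10))) (go (m ℕ./ 10))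
  where
  go : ∀ k → P (k ℕ.* 10 ℕ.+ m ℕ.% 10)
  go zero    = base (m ℕ.% 10) (m%n<n m 10)
  go (suc k) = ind _ (go k)

q a t b : (ℕ → ℤ) → ℕ → ℤ
q f = fold₂ 1ℤ f
a f = fold₂ -1ℤ f
t f = fold₃ 1ℤ (q f)
b f = fold₃ -1ℤ (a f)

module Folds {f : ℕ → ℤ} (W : Weighing f) where
  open Weighing W

  module _ {ε : ℤ} (ε² : ε * ε ≡ 1ℤ) where

    fold₂-corr-0 : corr 30 (fold₂ ε f) 0 ≡ + 36
    fold₂-corr-0 = trans (corr-fold₂ {ε} ε² f periodic 0) (trans (cong₂ (λ u v → u + ε * v) corr-0 (corr-c 30 (s≤s z≤n) (ℕ.m≤m+n 31 29)))
      (trans (cong (_+_ (+ 36)) (*-zeroʳ ε)) (+-identityʳ (+ 36))))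

    fold₂-corr-c : ∀ c → 0 ℕ.< c → c ℕ.< 30 → corr 30 (fold₂ ε f) c ≡ 0ℤ
    fold₂-corr-c c 0<c c<30 = trans (corr-fold₂ {ε} ε² f periodic c)
      (trans (cong₂ (λ u v → u + ε * v) (corr-c c 0<c (ℕ.<-≤-trans c<30 (ℕ.m≤m+n 30 30))) (corr-c (30 ℕ.+ c) (s≤s z≤n) (ℕ.+-monoʳ-< 30 c<30)))
        (trans (+-identityˡ (ε * 0ℤ)) (*-zeroʳ ε)))

    x = fold₂ ε f
    y = fold₃ ε x

    x-periodic : ∀ h → x (30 ℕ.+ h) ≡ ε * x h
    x-periodic = fold₂-periodic {ε} ε² f periodic

    y-periodic : ∀ h → y (10 ℕ.+ h) ≡ ε * y h
    y-periodic = fold₃-periodic {ε} ε² x x-periodic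

    fold₃-corr-0 : corr 10 y 0 ≡ + 36
    fold₃-corr-0 = trans (corr-fold₃ {ε} ε² x x-periodic 0) (trans
      (cong₂ _+_ (cong₂ (λ u v → u + ε * v) fold₂-corr-0 (fold₂-corr-c 10 (s≤s z≤n) (ℕ.m≤m+n 11 19))) (fold₂-corr-c 20 (s≤s z≤n) (ℕ.m≤m+n 21 9)))
      (cong (λ z → + 36 + z + 0ℤ) (*-zeroʳ ε)))

    fold₃-corr-c : ∀ c → 0 ℕ.< c → c ℕ.< 10 → corr 10 y c ≡ 0ℤ
    fold₃-corr-c c 0<c c<10 = trans (corr-fold₃ {ε} ε² x x-periodic c) (trans
      (cong₂ _+_ (cong₂ (λ u v → u + ε * v) (fold₂-corr-c c 0<c (ℕ.<-≤-trans c<10 (ℕ.m≤m+n 10 20)))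
                                            (fold₂-corr-c (10 ℕ.+ c) (s≤s z≤n) (ℕ.<-≤-trans (ℕ.+-monoʳ-< 10 c<10) (ℕ.m≤m+n 20 10))))
                 (fold₂-corr-c (20 ℕ.+ c) (s≤s z≤n) (ℕ.+-monoʳ-< 20 c<10)))
      (cong (λ z → 0ℤ + z + 0ℤ) (*-zeroʳ ε)))

    fold₃-∣ : ∀ {n} → n ∣ + 36 → ∀ c → c ℕ.< 10 → n ∣ corr 10 y c
    fold₃-∣ n∣36 zero    _    = subst (_ ∣_) (sym fold₃-corr-0) n∣36
    fold₃-∣ n∣36 (suc c) c<10 = subst (_ ∣_) (sym (fold₃-corr-c (suc c) (s≤s z≤n) c<10)) (divides 0ℤ refl)

  t-mod-3 : ∀ m → m ℕ.< 10 → t f m %ℕ 3 ≡ 0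
  t-mod-3 = mod-3-vanishing (t f) (λ h → ≈-reflexive (y-periodic {1ℤ} refl h))
    (λ c c≤5 → fold₃-∣ {1ℤ} refl {+ 3} (divides (+ 12) refl) c (ℕ.≤-trans (s≤s c≤5) (ℕ.m≤m+n 6 4)))

  t-divisible : ∀ m → + 3 ∣ t f m
  t-divisible = by-period (λ m m<10 → %ℕ≡0⇒∣ (t f m) 3 (t-mod-3 m m<10))
    (λ m 3∣t → subst (+ 3 ∣_) (sym (trans (y-periodic {1ℤ} refl m) (*-identityˡ (t f m)))) 3∣t)

  b-even : ∀ m → m ℕ.< 10 → (b f m %ℕ 4) ℕ.% 2 ≡ 0
  b-even = negacyclic-even (b f) (y-periodic { -1ℤ} refl)
    (λ c c≤9 → fold₃-∣ { -1ℤ} refl {+ 4} (divides (+ 9) refl) c (s≤s c≤9))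

  q-step : ∀ m → m ℕ.< 10 → (q f m - q f (10 ℕ.+ m)) %ℕ 3 ≡ 0
  q-step = mod-3-vanishing (step (q f) per₁ u sum₃) (step-periodic (q f) per₁ u sum₃) orth
    where
    per₁ = x-periodic {1ℤ} refl
    u : ℕ → ℤ
    u m = _∣_.quotient (t-divisible m)
    sum₃ : ∀ m → t f m ≡ u m * + 3
    sum₃ m = _∣_.equality (t-divisible m)
    orth : ∀ c → c ℕ.≤ 5 → + 3 ∣ corr 10 (step (q f) per₁ u sum₃) c
    -- At shift 0 the combination is 2 · 36 = 8 · 9; at the other shifts it is 0.
    orth zero _ = step-corr (q f) per₁ u sum₃ 0 (+ 8) (cong₂ _-_ (cong₂ (λ v w → + 2 * v - w) (fold₂-corr-0 {1ℤ} refl)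
      (fold₂-corr-c {1ℤ} refl 10 (s≤s z≤n) (ℕ.m≤m+n 11 19))) (fold₂-corr-c {1ℤ} refl 20 (s≤s z≤n) (ℕ.m≤m+n 21 9)))
    orth c@(suc _) c≤5 = step-corr (q f) per₁ u sum₃ c 0ℤ (cong₂ _-_ (cong₂ (λ v w → + 2 * v - w)
      (fold₂-corr-c {1ℤ} refl c (s≤s z≤n) (s≤s (ℕ.≤-trans c≤5 (ℕ.m≤m+n 5 24))))
      (fold₂-corr-c {1ℤ} refl (10 ℕ.+ c) (s≤s z≤n) (ℕ.+-monoʳ-< 10 (s≤s (ℕ.≤-trans c≤5 (ℕ.m≤m+n 5 14))))))
      (fold₂-corr-c {1ℤ} refl (20 ℕ.+ c) (s≤s z≤n) (ℕ.+-monoʳ-< 20 (s≤s (ℕ.≤-trans c≤5 (ℕ.m≤m+n 5 4))))))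

-- The final search

-- The row sums of a are a single ±6, or ±2 throughout with one of four sign patterns.
sumClasses : List (List ℕ)
sumClasses =
    (3 ∷ 0 ∷ 0 ∷ 0 ∷ 0 ∷ 0 ∷ 0 ∷ 0 ∷ 0 ∷ [])
  ∷ (0 ∷ 3 ∷ 0 ∷ 0 ∷ 0 ∷ 0 ∷ 0 ∷ 0 ∷ 0 ∷ [])
  ∷ (0 ∷ 0 ∷ 3 ∷ 0 ∷ 0 ∷ 0 ∷ 0 ∷ 0 ∷ 0 ∷ [])
  ∷ (0 ∷ 0 ∷ 0 ∷ 3 ∷ 0 ∷ 0 ∷ 0 ∷ 0 ∷ 0 ∷ [])
  ∷ (0 ∷ 0 ∷ 0 ∷ 0 ∷ 3 ∷ 0 ∷ 0 ∷ 0 ∷ 0 ∷ [])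
  ∷ (0 ∷ 0 ∷ 0 ∷ 0 ∷ 0 ∷ 3 ∷ 0 ∷ 0 ∷ 0 ∷ [])
  ∷ (0 ∷ 0 ∷ 0 ∷ 0 ∷ 0 ∷ 0 ∷ 3 ∷ 0 ∷ 0 ∷ [])
  ∷ (0 ∷ 0 ∷ 0 ∷ 0 ∷ 0 ∷ 0 ∷ 0 ∷ 3 ∷ 0 ∷ [])
  ∷ (0 ∷ 0 ∷ 0 ∷ 0 ∷ 0 ∷ 0 ∷ 0 ∷ 0 ∷ 3 ∷ [])
  ∷ (2 ∷ 2 ∷ 1 ∷ 2 ∷ 1 ∷ 1 ∷ 1 ∷ 1 ∷ 2 ∷ [])
  ∷ (2 ∷ 1 ∷ 1 ∷ 1 ∷ 1 ∷ 2 ∷ 1 ∷ 2 ∷ 2 ∷ [])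
  ∷ (1 ∷ 2 ∷ 2 ∷ 2 ∷ 2 ∷ 1 ∷ 2 ∷ 1 ∷ 1 ∷ [])
  ∷ (1 ∷ 1 ∷ 2 ∷ 1 ∷ 2 ∷ 2 ∷ 2 ∷ 2 ∷ 1 ∷ [])
  ∷ []

-- The leading 0 is the sum of a over the constant row. Squares adding up to 36 bound every
-- autocorrelation by 36 in absolute value, so vanishing modulo 64 means vanishing.
sumsClassified : List ℕ → Bool
sumsClassified xs = autocorrelated 64 63 9 (0 ∷ xs) implies ⌊ map sumClass xs ∈? sumClasses ⌋

search-sums : search (applyUpTo (λ _ → evens) 9) 36 sumsClassified ≡ true
search-sums = refl

zeroRow : Row
zeroRow = 0 , 0 , 0

-- Shifts up to 15 suffice because a negacyclic autocorrelation of length 30 changes sign under c ↦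
-- 30 - c. The test modulo 4 comes before the signs of the entries ±2 are chosen; as the norm is 36,
-- the test modulo 128 is exact.
refute₁₂₈ refute₄ : List Row → Bool
refute₁₂₈ rs = autocorrelated 128 127 15 (flat (zeroRow ∷ rs)) implies false
refute₄   rs = autocorrelated 4 3 15 (flat (zeroRow ∷ rs)) implies search (map liftRow rs) 0 refute₁₂₈

firstHole : List ℕ → ℕ
firstHole []           = 0
firstHole (zero  ∷ ps) = firstHole ps
firstHole (suc p ∷ _)  = suc p

refuteSums : List ℕ → List ℕ → Bool
refuteSums ps cs = search (zipWith rows₄ ps cs) 36 refute₄

-- A shift by 20 rotates all rows, so the first hole may be assumed to be in position 1.
refuteHoles : List ℕ → Bool
refuteHoles ps = (firstHole ps ≡ᵇ 1) implies
  (autocorrelated 2 1 15 (flat (zeroRow ∷ map parities ps)) implies all (refuteSums ps) sumClasses)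

-- The budget 4 counts the non-zero rows besides the constant one: (36 - 12) / 6.
search-holes : search (applyUpTo (λ _ → holes) 9) 4 refuteHoles ≡ true
search-holes = refl

-- Auxiliary facts on finite sums and first holes

all-∈ : ∀ {A : Set} (test : A → Bool) {x xs} → x ∈ xs → all test xs ≡ true → test x ≡ true
all-∈ test (here refl) ok = proj₁ (∧-true ok)
all-∈ test (there i)   ok = all-∈ test i (proj₂ (∧-true ok))

∑ℕ-∑ : ∀ n {w F} → (∀ m → m ℕ.< n → + w m ≡ F m) → + ∑ℕ n w ≡ ∑ n F
∑ℕ-∑ zero        eq = sym (∑-zero _)
∑ℕ-∑ (suc n) {w} {F} eq = trans (pos-+ (w 0) _) (trans (cong₂ _+_ (eq 0 (s≤s z≤n)) (∑ℕ-∑ n (λ m m<n → eq (suc m) (s≤s m<n)))) (sym (∑-suc n F)))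

∑ℕ-* : ∀ n k w → ∑ℕ n (λ m → k ℕ.* w m) ≡ k ℕ.* ∑ℕ n w
∑ℕ-* zero    k w = sym (ℕ.*-zeroʳ k)
∑ℕ-* (suc n) k w = trans (cong (k ℕ.* w 0 ℕ.+_) (∑ℕ-* n k (w ∘ suc))) (sym (ℕ.*-distribˡ-+ k (w 0) _))

∑ℕ≡0 : ∀ n {w} → ∑ℕ n w ≡ 0 → ∀ m → m ℕ.< n → w m ≡ 0
∑ℕ≡0 (suc n) {w} eq zero    _         = ℕ.m+n≡0⇒m≡0 (w 0) eq
∑ℕ≡0 (suc n) {w} eq (suc m) (s≤s m<n) = ∑ℕ≡0 n (ℕ.m+n≡0⇒n≡0 (w 0) eq) m m<n

∑ℕ-positive : ∀ n {w k} → ∑ℕ n w ≡ suc k → ∃ λ m → m ℕ.< n × ∃ λ j → w m ≡ suc j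
∑ℕ-positive (suc n) {w} eq with w 0 in eq₀
... | suc j = 0 , s≤s z≤n , j , eq₀
... | zero  with ∑ℕ-positive n eq
...   | m , m<n , j , eqₘ = suc m , s≤s m<n , j , eqₘ

∈?-true : ∀ {x xs} → ⌊ x ∈? xs ⌋ ≡ true → x ∈ xs
∈?-true {x} {xs} eq with x ∈? xs
... | yes i = i

pick : ∀ n {w k} → ∑ℕ n w ≡ suc k → (∀ m → m ℕ.< n → w m ≡ suc k ⊎ w m ≡ 0) → ∃ λ m → w m ≡ suc k
pick n sum dich with ∑ℕ-positive n sum
... | m , m<n , j , eq with dich m m<n
...   | inj₁ eq₁ = m , eq₁
...   | inj₂ eq₀ with trans (sym eq) eq₀
...     | ()

square : ℤ → ℕ
square x = ∣ x ∣ ℕ.* ∣ x ∣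

+square : ∀ x → + square x ≡ x * x
+square (+ n)    = pos-* n n
+square -[1+ n ] = refl

square≡0 : ∀ x → square x ≡ 0 → x ≡ 0ℤ
square≡0 x eq with ℕ.m*n≡0⇒m≡0∨n≡0 ∣ x ∣ eq
... | inj₁ p = ∣i∣≡0⇒i≡0 p
... | inj₂ p = ∣i∣≡0⇒i≡0 p

firstHole-rotate : ∀ n p → firstHole (applyUpTo (rotate ∘ p) n) ≡ rotate (firstHole (applyUpTo p n))
firstHole-rotate zero    p = refl
firstHole-rotate (suc n) p with p 0
... | 0 = firstHole-rotate n (p ∘ suc)
... | 1 = refl
... | 2 = refl
... | suc (suc (suc _)) = refl

firstHole≡0 : ∀ n p → firstHole (applyUpTo p n) ≡ 0 → ∑ℕ n (occupied ∘ p) ≡ 0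
firstHole≡0 zero    p eq = refl
firstHole≡0 (suc n) p eq with p 0
... | 0 = firstHole≡0 n (p ∘ suc) eq

applyUpTo-cong : ∀ {A : Set} n {f g : ℕ → A} → (∀ m → m ℕ.< n → f m ≡ g m) → applyUpTo f n ≡ applyUpTo g n
applyUpTo-cong zero    eq = refl
applyUpTo-cong (suc n) eq = cong₂ _∷_ (eq 0 (s≤s z≤n)) (applyUpTo-cong n (λ m m<n → eq (suc m) (s≤s m<n)))

open module Constant {s₀ s₁ s₂ s₃ s₄ s₅} = RowOf.Constant {s₀} {s₁} {s₂} {s₃} {s₄} {s₅} using (t²≡36; a₀≡0; a₁≡0; a₂≡0)
open module Balanced {s₀ s₁ s₂ s₃ s₄ s₅} = RowOf.Balanced {s₀} {s₁} {s₂} {s₃} {s₄} {s₅} hiding (q-norm)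

-- The rows of a weighing sequence

module RowAt (f : ℕ → ℤ) (m : ℕ) =
  RowOf (f m) (f (10 ℕ.+ m)) (f (20 ℕ.+ m)) (f (30 ℕ.+ m)) (f (40 ℕ.+ m)) (f (50 ℕ.+ m))

module RowSums {f : ℕ → ℤ} (W : Weighing f) where
  open Weighing W
  open Folds W

  t-square-sum : ∑ℕ 10 (λ m → square (t f m)) ≡ 36
  t-square-sum = +-injective (trans (∑ℕ-∑ 10 {λ m → square (t f m)} {λ m → t f m * t f m} (λ m _ → +square (t f m))) (fold₃-corr-0 {1ℤ} refl))

  row : ∀ m → m ℕ.< 10 → RowAt.Constant f m ⊎ RowAt.Balanced f m
  row m m<10 = dichotomy (f m) (trit m) (f (10 ℕ.+ m)) (trit (10 ℕ.+ m)) (f (20 ℕ.+ m)) (trit (20 ℕ.+ m))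
    (f (30 ℕ.+ m)) (trit (30 ℕ.+ m)) (f (40 ℕ.+ m)) (trit (40 ℕ.+ m)) (f (50 ℕ.+ m)) (trit (50 ℕ.+ m))
    (b-even m m<10) (t-mod-3 m m<10) (q-step m m<10)

  square-t : ∀ m → m ℕ.< 10 → square (t f m) ≡ 36 ⊎ square (t f m) ≡ 0
  square-t m m<10 = Sum.map square≡36 square≡0′ (row m m<10)
    where
    square≡36 : RowAt.Constant f m → square (t f m) ≡ 36
    square≡36 const = +-injective (trans (+square (t f m)) (t²≡36 const))
    square≡0′ : RowAt.Balanced f m → square (t f m) ≡ 0
    square≡0′ bal = cong square {t f m} (t≡0 bal)

  -- Exactly one row of q is constant, since the row sums lie in {0, ±6} and their squares add up to 36.
  constant-row : ∃ λ m → square (t f m) ≡ 36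
  constant-row = pick 10 t-square-sum square-t

-- The constant row is now row 0; it uses up the total 36 of the squares of `t`, so the other nine
-- rows are balanced.
module Normalised {f : ℕ → ℤ} (W : Weighing f) (t₀ : square (t f 0) ≡ 36) where
  open Weighing W
  open Folds W
  open RowSums W

  constant₀ : RowAt.Constant f 0
  constant₀ = Sum.fromInj₁ (λ bal → ⊥-elim (36≢0 (trans (sym t₀) (cong square {t f 0} (t≡0 bal))))) (row 0 (s≤s z≤n))
    where
    36≢0 : 36 ≢ 0
    36≢0 ()

  t-vanishes : ∀ m → m ℕ.< 9 → t f (suc m) ≡ 0ℤ
  t-vanishes m m<9 = square≡0 (t f (suc m)) (∑ℕ≡0 9 {λ m → square (t f (suc m))}
    (ℕ.+-cancelˡ-≡ 36 (∑ℕ 9 (λ m → square (t f (suc m)))) 0 (trans (cong (ℕ._+ ∑ℕ 9 (λ m → square (t f (suc m)))) (sym t₀)) t-square-sum)) m m<9)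

  balanced₊ : ∀ m → m ℕ.< 9 → RowAt.Balanced f (suc m)
  balanced₊ m m<9 = Sum.fromInj₂ (λ const → ⊥-elim (0≢36 (trans (sym (cong (λ z → z * z) (t-vanishes m m<9))) (t²≡36 const)))) (row (suc m) (s≤s m<9))
    where
    0≢36 : 0ℤ ≢ + 36
    0≢36 ()

  p c norm : ℕ → ℕ
  p m = RowAt.p f (suc m)
  c m = RowAt.c f (suc m)
  norm m = RowAt.norm f (suc m)

  -- The norm 36 of q consists of 12 from the constant row and 6 from each occupied one.
  occupied-sum : ∑ℕ 9 (occupied ∘ p) ≡ 4
  occupied-sum = ℕ.*-cancelˡ-≡ (∑ℕ 9 (occupied ∘ p)) 4 6 (ℕ.+-cancelˡ-≡ 12 (6 ℕ.* ∑ℕ 9 (occupied ∘ p)) 24 (+-injective (begin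
    + (12 ℕ.+ 6 ℕ.* ∑ℕ 9 (occupied ∘ p))          ≡⟨ cong (λ n → + (12 ℕ.+ n)) (sym (∑ℕ-* 9 6 (occupied ∘ p))) ⟩
    + ∑ℕ 10 w                                       ≡⟨ ∑ℕ-∑ 10 w≡q² ⟩
    ∑ 10 (λ h → q f h * q f h + q f (10 ℕ.+ h) * q f (10 ℕ.+ h) + q f (20 ℕ.+ h) * q f (20 ℕ.+ h))
      ≡⟨ sym (Rows.corr₀ {1ℤ} (q f) (x-periodic {1ℤ} refl) 0) ⟩
    corr 30 (q f) 0                                 ≡⟨ fold₂-corr-0 {1ℤ} refl ⟩
    + 36                                            ∎)))
    where
    w : ℕ → ℕ
    w zero    = 12
    w (suc m) = 6 ℕ.* occupied (p m)
    w≡q² : ∀ h → h ℕ.< 10 → + w h ≡ q f h * q f h + q f (10 ℕ.+ h) * q f (10 ℕ.+ h) + q f (20 ℕ.+ h) * q f (20 ℕ.+ h)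
    w≡q² zero    _         = sym (Constant.q-norm constant₀)
    w≡q² (suc m) (s≤s m<9) = sym (Balanced.q-norm (balanced₊ m m<9))

  norm-sum : ∑ℕ 9 norm ≡ 36
  norm-sum = +-injective (begin
    + ∑ℕ 10 w                                       ≡⟨ ∑ℕ-∑ 10 w≡a² ⟩
    ∑ 10 (λ h → a f h * a f h + a f (10 ℕ.+ h) * a f (10 ℕ.+ h) + a f (20 ℕ.+ h) * a f (20 ℕ.+ h))
      ≡⟨ sym (Rows.corr₀ { -1ℤ} (a f) (x-periodic { -1ℤ} refl) 0) ⟩
    corr 30 (a f) 0                                 ≡⟨ fold₂-corr-0 { -1ℤ} refl ⟩
    + 36                                            ∎)
    where
    w : ℕ → ℕ
    w zero    = 0
    w (suc m) = norm m
    +∣squares∣ : ∀ x y z → + ∣ x * x + y * y + z * z ∣ ≡ x * x + y * y + z * z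
    +∣squares∣ x y z = subst (λ i → + ∣ i ∣ ≡ i) (cong₂ _+_ (cong₂ _+_ (+square x) (+square y)) (+square z)) refl
    w≡a² : ∀ h → h ℕ.< 10 → + w h ≡ a f h * a f h + a f (10 ℕ.+ h) * a f (10 ℕ.+ h) + a f (20 ℕ.+ h) * a f (20 ℕ.+ h)
    w≡a² zero    _ = sym (cong₂ _+_ (cong₂ _+_ (cong (λ z → z * z) (a₀≡0 constant₀)) (cong (λ z → z * z) (a₁≡0 constant₀))) (cong (λ z → z * z) (a₂≡0 constant₀)))
    w≡a² (suc m) _ = +∣squares∣ (a f (suc m)) (a f (11 ℕ.+ m)) (a f (21 ℕ.+ m))

  b₀ : b f 0 ≡ 0ℤ
  b₀ = cong₂ _+_ (cong₂ (λ x y → x + -1ℤ * y) (a₀≡0 constant₀) (a₁≡0 constant₀)) (a₂≡0 constant₀)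

  b-square-sum : ∑ℕ 9 (λ m → ∣ b f (suc m) * b f (suc m) ∣) ≡ 36
  b-square-sum = +-injective (trans (∑ℕ-∑ 10 w≡b²) (fold₃-corr-0 { -1ℤ} refl))
    where
    w : ℕ → ℕ
    w zero    = 0
    w (suc m) = ∣ b f (suc m) * b f (suc m) ∣
    w≡b² : ∀ h → h ℕ.< 10 → + w h ≡ b f h * b f h
    w≡b² zero    _ = sym (cong (λ z → z * z) b₀)
    w≡b² (suc m) _ = subst (λ i → + ∣ i ∣ ≡ i) (+square (b f (suc m))) refl

  rows : (n : ℕ) .{{_ : ℕ.NonZero n}} → List Row
  rows n = applyUpTo (λ m → residues n (a f (suc m)) (a f (11 ℕ.+ m)) (a f (21 ℕ.+ m))) 9

  -- The residues at the indices 0 to 29 regroup into `flat` by computation; only the vanishing of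
  -- row 0 has to be substituted.
  rows-autocorrelated : ∀ n .{{_ : ℕ.NonZero n}} e → + e ≈ -1ℤ [mod n ] → autocorrelated n e 15 (flat (zeroRow ∷ rows n)) ≡ true
  rows-autocorrelated n e e≈-1 = subst (λ r → autocorrelated n e 15 (flat (r ∷ rows n)) ≡ true) row₀
    (autocorrelated-true n e 15 { -1ℤ} {a f} {applyUpTo (λ h → a f h %ℕ n) 30} e≈-1
      (Reads-applyUpTo 30 (λ h → %ℕ-≈ (a f h) n)) (λ h → ≈-reflexive (x-periodic { -1ℤ} refl h)) (ℕ.m≤m+n 15 15)
      (λ c 0<c c≤15 → subst (_ ∣_) (sym (fold₂-corr-c { -1ℤ} refl c 0<c (ℕ.≤-trans (s≤s c≤15) (ℕ.m≤m+n 16 14)))) (divides 0ℤ refl)))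
    where
    row₀ : residues n (a f 0) (a f 10) (a f 20) ≡ zeroRow
    row₀ = cong₂ _,_ (vanish (a₀≡0 constant₀)) (cong₂ _,_ (vanish (a₁≡0 constant₀)) (vanish (a₂≡0 constant₀)))
      where
      vanish : ∀ {x} → x ≡ 0ℤ → x %ℕ n ≡ 0
      vanish refl = ℕ.n∣m⇒m%n≡0 0 n (n ℕ.∣0)

  sums : List ℕ
  sums = applyUpTo (λ m → b f (suc m) %ℕ 64) 9

  sums-autocorrelated : autocorrelated 64 63 9 (0 ∷ sums) ≡ true
  sums-autocorrelated = subst (λ d → autocorrelated 64 63 9 (d ∷ sums) ≡ true) (cong (_%ℕ 64) b₀)
    (autocorrelated-true 64 63 9 { -1ℤ} {b f} {applyUpTo (λ h → b f h %ℕ 64) 10} (congruent (divides 1ℤ refl))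
      (Reads-applyUpTo 10 (λ h → %ℕ-≈ (b f h) 64)) (λ h → ≈-reflexive (y-periodic { -1ℤ} refl h)) (ℕ.m≤m+n 9 1)
      (λ c 0<c c≤9 → subst (_ ∣_) (sym (fold₃-corr-c { -1ℤ} refl c 0<c (s≤s c≤9))) (divides 0ℤ refl)))

  classes-∈ : applyUpTo c 9 ∈ sumClasses
  classes-∈ = subst (_∈ sumClasses) (map-applyUpTo (λ m → b f (suc m) %ℕ 64) sumClass 9)
    (∈?-true (modus-ponens {autocorrelated 64 63 9 (0 ∷ sums)} found sums-autocorrelated))
    where
    found : sumsClassified sums ≡ true
    found = search-sound 9 (λ _ → evens) {test = sumsClassified} (λ m → ∣ b f (suc m) * b f (suc m) ∣) (λ m → b f (suc m) %ℕ 64)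
      (λ m m<9 → even-∈ (balanced₊ m m<9)) b-square-sum search-sums

  -- The data of `f` pass through the nested searches in order: holes, parities, classes of row
  -- sums, rows modulo 4, rows modulo 128. The last search says that the autocorrelation test fails,
  -- yet the rows pass it.
  firstHole≢1 : firstHole (applyUpTo p 9) ≢ 1
  firstHole≢1 eq = false≢true (modus-ponens {autocorrelated 128 127 15 (flat (zeroRow ∷ rows 128))} lifted (rows-autocorrelated 128 127 (congruent (divides 1ℤ refl))))
    where
    false≢true : false ≢ true
    false≢true ()
    found : refuteHoles (applyUpTo p 9) ≡ true
    found = search-sound 9 (λ _ → holes) {test = refuteHoles} (occupied ∘ p) p
      (λ m m<9 → hole-∈ (balanced₊ m m<9)) occupied-sum search-holes
    parities-rows : map parities (applyUpTo p 9) ≡ rows 2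
    parities-rows = trans (map-applyUpTo p parities 9)
      (applyUpTo-cong 9 (λ m m<9 → sym (parity (balanced₊ m m<9))))
    refuted : all (refuteSums (applyUpTo p 9)) sumClasses ≡ true
    refuted = modus-ponens {autocorrelated 2 1 15 (flat (zeroRow ∷ map parities (applyUpTo p 9)))}
      (modus-ponens {firstHole (applyUpTo p 9) ≡ᵇ 1} found (cong (_≡ᵇ 1) eq))
      (subst (λ rs → autocorrelated 2 1 15 (flat (zeroRow ∷ rs)) ≡ true) (sym parities-rows) (rows-autocorrelated 2 1 (congruent (divides 1ℤ refl))))
    found₄ : refute₄ (rows 4) ≡ true
    found₄ = search-sound 9 (λ m → rows₄ (p m) (c m)) {test = refute₄} norm (λ m → residues 4 (a f (suc m)) (a f (11 ℕ.+ m)) (a f (21 ℕ.+ m)))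
      (λ m m<9 → row-∈ (balanced₊ m m<9)) norm-sum
      (all-∈ (refuteSums (applyUpTo p 9)) classes-∈ refuted)
    lifted : refute₁₂₈ (rows 128) ≡ true
    lifted = search-sound 9 (λ m → liftRow (residues 4 (a f (suc m)) (a f (11 ℕ.+ m)) (a f (21 ℕ.+ m)))) {test = refute₁₂₈} (λ _ → 0)
      (λ m → residues 128 (a f (suc m)) (a f (11 ℕ.+ m)) (a f (21 ℕ.+ m)))
      (λ m m<9 → lift-∈ (balanced₊ m m<9)) (∑ℕ-0 9)
      (modus-ponens {autocorrelated 4 3 15 (flat (zeroRow ∷ rows 4))} found₄ (rows-autocorrelated 4 3 (congruent (divides 1ℤ refl))))

-- Rotation of the first hole

firstHole-impossible : ∀ n p → ∑ℕ n (occupied ∘ p) ≡ 4 → let h = firstHole (applyUpTo p n) in h ≢ 1 → rotate h ≢ 1 → rotate (rotate h) ≢ 1 → ⊥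
firstHole-impossible n p sum h≢1 h≢3 h≢2 with firstHole (applyUpTo p n) in eq
-- Having no hole contradicts the count 4; otherwise one of the three rotations of the first hole is
-- 1.
... | 0 with trans (sym sum) (firstHole≡0 n p eq)
...   | ()
firstHole-impossible n p sum h≢1 h≢3 h≢2 | 1 = h≢1 refl
firstHole-impossible n p sum h≢1 h≢3 h≢2 | 2 = h≢2 refl
firstHole-impossible n p sum h≢1 h≢3 h≢2 | suc (suc (suc _)) = h≢3 refl

t-shift : ∀ f m → t (f ∘ (m ℕ.+_)) 0 ≡ t f m
t-shift f m = cong₂ _+_ (cong₂ (λ x y → x + 1ℤ * y) (q-shift 0) (q-shift 10)) (q-shift 20)
  where
  q-shift : ∀ k → q (f ∘ (m ℕ.+_)) k ≡ q f (k ℕ.+ m)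
  q-shift k = cong₂ (λ i j → f i + 1ℤ * f j) (ℕ.+-comm m k) (ℕ.+-comm m (30 ℕ.+ k))

-- A shift by 20 keeps the constant row at index 0, because `t` has period 10.
t₀-shift : ∀ {f} → Weighing f → square (t f 0) ≡ 36 → square (t (f ∘ (20 ℕ.+_)) 0) ≡ 36
t₀-shift {f} W t₀ = trans (cong square (trans (t-shift f 20) (trans (t-periodic 10) (t-periodic 0)))) t₀
  where
  open Folds W
  t-periodic : ∀ h → t f (10 ℕ.+ h) ≡ t f h
  t-periodic h = trans (y-periodic {1ℤ} refl h) (*-identityˡ (t f h))

-- Modulo 30 the indices 20 + m, 30 + m, 40 + m turn a row (q₀, q₁, q₂) into (q₂, q₀, q₁).
hole-shift : ∀ {f} (W : Weighing f) (t₀ : square (t f 0) ≡ 36) →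
  applyUpTo (Normalised.p (shift 20 W) (t₀-shift W t₀)) 9 ≡ applyUpTo (rotate ∘ Normalised.p W t₀) 9
hole-shift {f} W t₀ = applyUpTo-cong 9 (λ m m<9 → trans
  (cong₂ (hole (q f (21 ℕ.+ m))) (q-periodic (suc m)) (q-periodic (11 ℕ.+ m)))
  (rotated (Normalised.balanced₊ W t₀ m m<9)))
  where
  open Folds W
  q-periodic : ∀ h → q f (30 ℕ.+ h) ≡ q f h
  q-periodic h = trans (x-periodic {1ℤ} refl h) (*-identityˡ (q f h))

no-normalised : ∀ {f} → Weighing f → square (t f 0) ≡ 36 → ⊥
no-normalised {f} W t₀ = firstHole-impossible 9 (p W t₀) (occupied-sum W t₀)
  (firstHole≢1 W t₀)
  (λ eq → firstHole≢1 W′ t₀′ (trans first′ eq))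
  (λ eq → firstHole≢1 W″ t₀″ (trans first″ eq))
  where
  open Normalised
  W′ = shift 20 W
  t₀′ = t₀-shift W t₀
  W″ = shift 20 W′
  t₀″ = t₀-shift W′ t₀′
  first′ : firstHole (applyUpTo (p W′ t₀′) 9) ≡ rotate (firstHole (applyUpTo (p W t₀) 9))
  first′ = trans (cong firstHole (hole-shift W t₀)) (firstHole-rotate 9 (p W t₀))
  first″ : firstHole (applyUpTo (p W″ t₀″) 9) ≡ rotate (rotate (firstHole (applyUpTo (p W t₀) 9)))
  first″ = trans (cong firstHole (hole-shift W′ t₀′)) (trans (firstHole-rotate 9 (p W′ t₀′)) (cong rotate first′))

no-weighing : ∀ {f} → Weighing f → ⊥
no-weighing {f} W = go (RowSums.constant-row W)
  where
  go : (∃ λ m → square (t f m) ≡ 36) → ⊥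
  go (m , t²) = no-normalised (shift m W) (trans (cong square (t-shift f m)) t²)

mainTheorem17 : (S : GR) → IsCW60-36 S →
    (χ : C60 → Zζ) → IsCharacter χ → HasOrder60 χ →
    Equivalent (applyChar χ S) θ₁ ⊎ Equivalent (applyChar χ S) θ₂
mainTheorem17 S cw _ _ _ = ⊥-elim (no-weighing (weighing S cw))
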